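{- Let $\mathbb{K}$ be a commutative ring with unit, $n\ge 1$ an integer and $M$ a matroid. The Tutte polynomial satisfies the following iterated convolution formula in the polynomial algebra $\mathbb{K}[a_1,\ldots,a_n,b_1,\ldots,b_n]$: $$\mathfrak{T}_M(1-a_1\cdots a_n,\,1-b_1\cdots b_n)=\sum_{\varnothing=A_0\subseteq A_1\subseteq\cdots\subseteq A_n=E(M)}\ \prod_{i=1}^n a_i^{\mathrm{rk}(M/A_i)}\,b_i^{\mathrm{cork}(M|A_{i-1})}\,\mathfrak{T}_{M|A_i/A_{i-1}}(1-a_i,\,1-b_i).$$
   Context: For a matroid $M$ with finite ground set $E(M)$ and rank function $\mathrm{rk}$: $\mathrm{rk}(M)=\mathrm{rk}(E(M))$, $\mathrm{cork}(M)=|E(M)|-\mathrm{rk}(M)$, and the Tutte polynomial is $\mathfrak{T}_M(x,y)=\sum_{A\subseteq E(M)}(x-1)^{\mathrm{rk}(M)-\mathrm{rk}(A)}(y-1)^{|A|-\mathrm{rk}(A)}$. $M|A$ is the restriction of $M$ to $A$, and $M/A$ is the contraction, a matroid on $E(M)\setminus A$ with rank function $B\mapsto \mathrm{rk}(A\cup B)-\mathrm{rk}(A)$. $M|A_i/A_{i-1}$ means $(M|A_i)/A_{i-1}$. -}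

module Defs where

open import Algebra.Bundles using (CommutativeRing)
import Algebra.Definitions.RawMonoid as RawMonoidDefs
import Algebra.Properties.CommutativeSemigroup as CSemigroup
import Algebra.Properties.AbelianGroup as AbelianGroupProps
import Algebra.Properties.Ring as RingProps
import Data.Bool.Properties as Bool
open import Data.Fin using (Fin; zero; suc; inject₁; fromℕ)
open import Data.Fin.Properties using (all?)
open import Data.Fin.Subset using (Subset; inside; outside; _⊆_; _∪_; _∩_; _─_; ⊥; ∣_∣)
open import Data.Fin.Subset.Properties
  using (_⊆?_; p∩q⊆p; p∩q⊆q; p⊆p∪q; q⊆p∪q; p─q⊆p; x∈p∪q⁻;
         ∪-distribˡ-∩; ∪-assoc; ∪-comm; ∪-idem)
open import Data.List using (List; []; _∷_; [_]; _++_; map; foldr; filter; cartesianProductWith)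
open import Data.Nat using (ℕ; zero; suc; _∸_; _≤_)
import Data.Nat as ℕ
import Data.Nat.Properties as ℕ
open import Data.Product using (_×_; _,_; ∃)
open import Data.Sum using ([_,_]′)
open import Data.Vec using (Vec; []; _∷_; lookup; zipWith; replicate; _[_]≔_)
import Data.Vec.Properties as Vec
open import Level using (Level)
open import Relation.Binary.PropositionalEquality as ≡ using (_≡_; refl; cong; cong₂)
open import Relation.Nullary using (Dec; yes; no; ¬_; contradiction)
open import Relation.Nullary.Decidable using (_×-dec_)

private
  variable
    c ℓ : Level
    k n N : ℕ

------------------------------------------------------------------------
-- Polynomial algebras

-- Exponent vectors in k variables.
Monomial : ℕ → Set
Monomial k = Vec ℕ k

infixl 6 _⊕_
_⊕_ : Monomial k → Monomial k → Monomial k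
_⊕_ = zipWith ℕ._+_

infix 4 _≟ₘ_
_≟ₘ_ : (e f : Monomial k) → Dec (e ≡ f)
_≟ₘ_ = Vec.≡-dec ℕ._≟_

module Polynomials (K : CommutativeRing c ℓ) (k : ℕ) where
  private module K = CommutativeRing K

  -- A polynomial is a finite formal sum of terms (coefficient , exponents).
  -- A monomial may occur in several terms, or with coefficient zero;
  -- polynomials are therefore compared by their coefficients.
  Poly : Set c
  Poly = List (K.Carrier × Monomial k)

  termCoeff : K.Carrier → {e m : Monomial k} → Dec (e ≡ m) → K.Carrier
  termCoeff x (yes _) = x
  termCoeff x (no  _) = K.0#

  coeff : Poly → Monomial k → K.Carrier
  coeff []            m = K.0#
  coeff ((x , e) ∷ p) m = termCoeff x (e ≟ₘ m) K.+ coeff p m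

  infix 4 _≋_
  record _≋_ (p q : Poly) : Set ℓ where
    constructor mk≋
    field coeff-≈ : ∀ m → coeff p m K.≈ coeff q m
  open _≋_ public

  mulTerm : K.Carrier × Monomial k → K.Carrier × Monomial k → K.Carrier × Monomial k
  mulTerm (x , e) (y , f) = x K.* y , e ⊕ f

  infixl 6 _+ₚ_
  infixl 7 _*ₚ_
  _+ₚ_ _*ₚ_ : Poly → Poly → Poly
  _+ₚ_ = _++_
  _*ₚ_ = cartesianProductWith mulTerm

  -ₚ_ : Poly → Poly
  -ₚ_ = map λ (x , e) → K.- x , e

  1ₘ : Monomial k
  1ₘ = replicate k 0

  0ₚ 1ₚ : Poly
  0ₚ = []
  1ₚ = [ K.1# , 1ₘ ]

  X : Fin k → Poly
  X i = [ K.1# , 1ₘ [ i ]≔ 1 ]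

  private
    open CSemigroup K.+-commutativeSemigroup using (x∙yz≈y∙xz)
    open import Relation.Binary.Reasoning.Setoid K.setoid

    ⊕-comm : ∀ {k} (e f : Monomial k) → e ⊕ f ≡ f ⊕ e
    ⊕-comm = Vec.zipWith-comm ℕ.+-comm

    ⊕-assoc : ∀ {k} (e f g : Monomial k) → (e ⊕ f) ⊕ g ≡ e ⊕ (f ⊕ g)
    ⊕-assoc = Vec.zipWith-assoc ℕ.+-assoc

    ⊕-identityˡ : ∀ {k} (e : Monomial k) → replicate k 0 ⊕ e ≡ e
    ⊕-identityˡ = Vec.zipWith-identityˡ ℕ.+-identityˡ

    ⊕-cancelˡ : ∀ {k} (e f g : Monomial k) → e ⊕ f ≡ e ⊕ g → f ≡ g
    ⊕-cancelˡ []      []      []      eq = refl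
    ⊕-cancelˡ (a ∷ e) (b ∷ f) (d ∷ g) eq =
      cong₂ _∷_ (ℕ.+-cancelˡ-≡ a b d (Vec.∷-injectiveˡ eq)) (⊕-cancelˡ e f g (Vec.∷-injectiveʳ eq))

    divides? : ∀ {k} (e m : Monomial k) → Dec (∃ λ g → e ⊕ g ≡ m)
    divides? []      []      = yes ([] , refl)
    divides? (a ∷ e) (b ∷ m) with a ℕ.≤? b | divides? e m
    ... | yes a≤b | yes (g , eq) = yes (b ∸ a ∷ g , cong₂ _∷_ (ℕ.m+[n∸m]≡n a≤b) eq)
    ... | no  a≰b | _            = no λ { (d ∷ g , refl) → a≰b (ℕ.m≤m+n a d) }
    ... | yes _   | no ¬g        = no λ { (d ∷ g , refl) → ¬g (g , refl) }

    termCoeff-cong : ∀ {x y} {e f m n : Monomial k} (d : Dec (e ≡ m)) (d′ : Dec (f ≡ n)) →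
                     x K.≈ y → (e ≡ m → f ≡ n) → (f ≡ n → e ≡ m) → termCoeff x d K.≈ termCoeff y d′
    termCoeff-cong (yes _) (yes _)  x≈y to from = x≈y
    termCoeff-cong (no _)  (no _)   x≈y to from = K.refl
    termCoeff-cong (yes p) (no ¬q)  x≈y to from = contradiction (to p) ¬q
    termCoeff-cong (no ¬p) (yes q)  x≈y to from = contradiction (from q) ¬p

    termCoeff-no : ∀ {x} {e m : Monomial k} (d : Dec (e ≡ m)) → ¬ e ≡ m → termCoeff x d K.≈ K.0#
    termCoeff-no (yes p) ¬p = contradiction p ¬p
    termCoeff-no (no _)  _  = K.refl

    termCoeff-* : ∀ x y {e m : Monomial k} (d : Dec (e ≡ m)) →
                  termCoeff (x K.* y) d K.≈ x K.* termCoeff y d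
    termCoeff-* x y (yes _) = K.refl
    termCoeff-* x y (no _)  = K.sym (K.zeroʳ x)

    termCoeff-neg : ∀ x {e m : Monomial k} (d : Dec (e ≡ m)) →
                    termCoeff (K.- x) d K.≈ K.- termCoeff x d
    termCoeff-neg x (yes _) = K.refl
    termCoeff-neg x (no _)  = K.sym (RingProps.-0#≈0# K.ring)

    ≋-refl : ∀ {p} → p ≋ p
    ≋-refl .coeff-≈ m = K.refl

    ≋-sym : ∀ {p q} → p ≋ q → q ≋ p
    ≋-sym p≋q .coeff-≈ m = K.sym (p≋q .coeff-≈ m)

    ≋-trans : ∀ {p q r} → p ≋ q → q ≋ r → p ≋ r
    ≋-trans p≋q q≋r .coeff-≈ m = K.trans (p≋q .coeff-≈ m) (q≋r .coeff-≈ m)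

    coeff-++ : ∀ p q m → coeff (p ++ q) m K.≈ coeff p m K.+ coeff q m
    coeff-++ []            q m = K.sym (K.+-identityˡ _)
    coeff-++ ((x , e) ∷ p) q m = begin
      termCoeff x (e ≟ₘ m) K.+ coeff (p ++ q) m             ≈⟨ K.+-congˡ (coeff-++ p q m) ⟩
      termCoeff x (e ≟ₘ m) K.+ (coeff p m K.+ coeff q m)    ≈⟨ K.+-assoc _ _ _ ⟨
      termCoeff x (e ≟ₘ m) K.+ coeff p m K.+ coeff q m      ∎

    coeff-neg : ∀ p m → coeff (-ₚ p) m K.≈ K.- coeff p m
    coeff-neg []            m = K.sym (RingProps.-0#≈0# K.ring)
    coeff-neg ((x , e) ∷ p) m = K.trans
      (K.+-cong (termCoeff-neg x (e ≟ₘ m)) (coeff-neg p m))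
      (AbelianGroupProps.⁻¹-∙-comm K.+-abelianGroup _ _)

    +-cong : ∀ {p p′ q q′} → p ≋ p′ → q ≋ q′ → (p ++ q) ≋ (p′ ++ q′)
    +-cong {p} {p′} {q} {q′} p≋ q≋ .coeff-≈ m = begin
      coeff (p ++ q) m            ≈⟨ coeff-++ p q m ⟩
      coeff p m K.+ coeff q m     ≈⟨ K.+-cong (p≋ .coeff-≈ m) (q≋ .coeff-≈ m) ⟩
      coeff p′ m K.+ coeff q′ m   ≈⟨ coeff-++ p′ q′ m ⟨
      coeff (p′ ++ q′) m          ∎

    +-assoc : ∀ p q r → ((p ++ q) ++ r) ≋ (p ++ (q ++ r))
    +-assoc []      q r = ≋-refl
    +-assoc (t ∷ p) q r .coeff-≈ m = K.+-congˡ (+-assoc p q r .coeff-≈ m)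

    +-comm : ∀ p q → (p ++ q) ≋ (q ++ p)
    +-comm p q .coeff-≈ m = begin
      coeff (p ++ q) m          ≈⟨ coeff-++ p q m ⟩
      coeff p m K.+ coeff q m   ≈⟨ K.+-comm _ _ ⟩
      coeff q m K.+ coeff p m   ≈⟨ coeff-++ q p m ⟨
      coeff (q ++ p) m          ∎

    +-identityʳ : ∀ p → (p ++ []) ≋ p
    +-identityʳ p = +-comm p []

    neg-cong : ∀ {p q} → p ≋ q → (-ₚ p) ≋ (-ₚ q)
    neg-cong {p} {q} p≋q .coeff-≈ m =
      K.trans (coeff-neg p m) (K.trans (K.-‿cong (p≋q .coeff-≈ m)) (K.sym (coeff-neg q m)))

    neg-inverseˡ : ∀ p → ((-ₚ p) ++ p) ≋ []
    neg-inverseˡ p .coeff-≈ m =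
      K.trans (coeff-++ (-ₚ p) p m) (K.trans (K.+-congʳ (coeff-neg p m)) (K.-‿inverseˡ _))

    coeff-scale : ∀ x e p g → coeff (map (mulTerm (x , e)) p) (e ⊕ g) K.≈ x K.* coeff p g
    coeff-scale x e []            g = K.sym (K.zeroʳ x)
    coeff-scale x e ((y , f) ∷ p) g = begin
      termCoeff (x K.* y) (e ⊕ f ≟ₘ e ⊕ g) K.+ coeff (map (mulTerm (x , e)) p) (e ⊕ g)
        ≈⟨ K.+-cong (termCoeff-cong (e ⊕ f ≟ₘ e ⊕ g) (f ≟ₘ g) K.refl (⊕-cancelˡ e f g) (cong (e ⊕_)))
                    (coeff-scale x e p g) ⟩
      termCoeff (x K.* y) (f ≟ₘ g) K.+ x K.* coeff p g
        ≈⟨ K.+-congʳ (termCoeff-* x y (f ≟ₘ g)) ⟩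
      x K.* termCoeff y (f ≟ₘ g) K.+ x K.* coeff p g
        ≈⟨ K.distribˡ x _ _ ⟨
      x K.* (termCoeff y (f ≟ₘ g) K.+ coeff p g) ∎

    coeff-scale-0 : ∀ x e p m → ¬ (∃ λ g → e ⊕ g ≡ m) → coeff (map (mulTerm (x , e)) p) m K.≈ K.0#
    coeff-scale-0 x e []            m ¬g = K.refl
    coeff-scale-0 x e ((y , f) ∷ p) m ¬g = K.trans
      (K.+-cong (termCoeff-no (e ⊕ f ≟ₘ m) (λ eq → ¬g (f , eq))) (coeff-scale-0 x e p m ¬g))
      (K.+-identityˡ _)

    scale-cong : ∀ t {p q} → p ≋ q → map (mulTerm t) p ≋ map (mulTerm t) q
    scale-cong (x , e) {p} {q} p≋q .coeff-≈ m with divides? e m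
    ... | yes (g , refl) = begin
      coeff (map (mulTerm (x , e)) p) (e ⊕ g)  ≈⟨ coeff-scale x e p g ⟩
      x K.* coeff p g                          ≈⟨ K.*-congˡ (p≋q .coeff-≈ g) ⟩
      x K.* coeff q g                          ≈⟨ coeff-scale x e q g ⟨
      coeff (map (mulTerm (x , e)) q) (e ⊕ g)  ∎
    ... | no ¬g = K.trans (coeff-scale-0 x e p m ¬g) (K.sym (coeff-scale-0 x e q m ¬g))

    scale-++ : ∀ t p q → map (mulTerm t) (p ++ q) ≡ map (mulTerm t) p ++ map (mulTerm t) q
    scale-++ t []      q = refl
    scale-++ t (s ∷ p) q = cong (mulTerm t s ∷_) (scale-++ t p q)

    ≋-reflexive : ∀ {p q} → p ≡ q → p ≋ q
    ≋-reflexive refl = ≋-refl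

    ∷-cong : ∀ {x y e f p q} → x K.≈ y → e ≡ f → p ≋ q → ((x , e) ∷ p) ≋ ((y , f) ∷ q)
    ∷-cong {x} {y} {e} x≈y refl p≋q .coeff-≈ m =
      K.+-cong (termCoeff-cong (e ≟ₘ m) (e ≟ₘ m) x≈y (λ z → z) (λ z → z)) (p≋q .coeff-≈ m)

    *-congʳ-list : ∀ p {q q′} → q ≋ q′ → (p *ₚ q) ≋ (p *ₚ q′)
    *-congʳ-list []      q≋ = ≋-refl
    *-congʳ-list (t ∷ p) q≋ = +-cong (scale-cong t q≋) (*-congʳ-list p q≋)

    *-[] : ∀ p → (p *ₚ []) ≡ []
    *-[] []      = refl
    *-[] (t ∷ p) = *-[] p

    swap-++ : ∀ p q r → (p ++ (q ++ r)) ≋ (q ++ (p ++ r))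
    swap-++ p q r .coeff-≈ m = begin
      coeff (p ++ (q ++ r)) m                      ≈⟨ coeff-++ p (q ++ r) m ⟩
      coeff p m K.+ coeff (q ++ r) m               ≈⟨ K.+-congˡ (coeff-++ q r m) ⟩
      coeff p m K.+ (coeff q m K.+ coeff r m)      ≈⟨ x∙yz≈y∙xz _ _ _ ⟩
      coeff q m K.+ (coeff p m K.+ coeff r m)      ≈⟨ K.+-congˡ (coeff-++ p r m) ⟨
      coeff q m K.+ coeff (p ++ r) m               ≈⟨ coeff-++ q (p ++ r) m ⟨
      coeff (q ++ (p ++ r)) m                      ∎

    *-∷ : ∀ p t q → (p *ₚ (t ∷ q)) ≋ (map (mulTerm t) p ++ (p *ₚ q))
    *-∷ []            t       q = ≋-refl
    *-∷ ((x , e) ∷ p) (y , f) q = ∷-cong (K.*-comm x y) (⊕-comm e f)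
      (≋-trans (+-cong (≋-refl {map (mulTerm (x , e)) q}) (*-∷ p (y , f) q))
               (swap-++ (map (mulTerm (x , e)) q) (map (mulTerm (y , f)) p) (p *ₚ q)))

    *-comm : ∀ p q → (p *ₚ q) ≋ (q *ₚ p)
    *-comm []      q = ≋-reflexive (≡.sym (*-[] q))
    *-comm (t ∷ p) q =
      ≋-trans (+-cong (≋-refl {map (mulTerm t) q}) (*-comm p q)) (≋-sym (*-∷ q t p))

    *-cong : ∀ {p p′ q q′} → p ≋ p′ → q ≋ q′ → (p *ₚ q) ≋ (p′ *ₚ q′)
    *-cong {p} {p′} {q} {q′} p≋ q≋ =
      ≋-trans (*-congʳ-list p q≋)
        (≋-trans (*-comm p q′) (≋-trans (*-congʳ-list q′ p≋) (*-comm q′ p′)))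

    distribʳ : ∀ r p q → ((p ++ q) *ₚ r) ≋ ((p *ₚ r) ++ (q *ₚ r))
    distribʳ r []      q = ≋-refl
    distribʳ r (t ∷ p) q =
      ≋-trans (+-cong (≋-refl {map (mulTerm t) r}) (distribʳ r p q))
              (≋-sym (+-assoc (map (mulTerm t) r) (p *ₚ r) (q *ₚ r)))

    distribˡ : ∀ r p q → (r *ₚ (p ++ q)) ≋ ((r *ₚ p) ++ (r *ₚ q))
    distribˡ r p q =
      ≋-trans (*-comm r (p ++ q)) (≋-trans (distribʳ r p q) (+-cong (*-comm p r) (*-comm q r)))

    scale-mul : ∀ s t r → map (mulTerm (mulTerm s t)) r ≋ map (mulTerm s) (map (mulTerm t) r)
    scale-mul s t [] = ≋-refl
    scale-mul (x , e) (y , f) ((z , g) ∷ r) =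
      ∷-cong (K.*-assoc x y z) (⊕-assoc e f g) (scale-mul (x , e) (y , f) r)

    scale-* : ∀ t q r → (map (mulTerm t) q *ₚ r) ≋ map (mulTerm t) (q *ₚ r)
    scale-* t []      r = ≋-refl
    scale-* t (s ∷ q) r =
      ≋-trans (+-cong (scale-mul t s r) (scale-* t q r))
              (≋-reflexive (≡.sym (scale-++ t (map (mulTerm s) r) (q *ₚ r))))

    *-assoc : ∀ p q r → ((p *ₚ q) *ₚ r) ≋ (p *ₚ (q *ₚ r))
    *-assoc []      q r = ≋-refl
    *-assoc (t ∷ p) q r =
      ≋-trans (distribʳ r (map (mulTerm t) q) (p *ₚ q))
              (+-cong (scale-* t q r) (*-assoc p q r))

    scale-1 : ∀ p → map (mulTerm (K.1# , 1ₘ)) p ≋ p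
    scale-1 []            = ≋-refl
    scale-1 ((x , e) ∷ p) = ∷-cong (K.*-identityˡ x) (⊕-identityˡ e) (scale-1 p)

    *-identityˡ : ∀ p → (1ₚ *ₚ p) ≋ p
    *-identityˡ p = ≋-trans (+-identityʳ _) (scale-1 p)

  polynomialRing : CommutativeRing c ℓ
  polynomialRing = record
    { Carrier = Poly
    ; _≈_ = _≋_
    ; _+_ = _+ₚ_
    ; _*_ = _*ₚ_
    ; -_ = -ₚ_
    ; 0# = 0ₚ
    ; 1# = 1ₚ
    ; isCommutativeRing = record
      { isRing = record
        { +-isAbelianGroup = record
          { isGroup = record
            { isMonoid = record
              { isSemigroup = record
                { isMagma = record
                  { isEquivalence = record { refl = ≋-refl ; sym = ≋-sym ; trans = ≋-trans }
                  ; ∙-cong = +-cong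
                  }
                ; assoc = +-assoc
                }
              ; identity = (λ p → ≋-refl) , +-identityʳ
              }
            ; inverse = neg-inverseˡ , λ p → ≋-trans (+-comm p (-ₚ p)) (neg-inverseˡ p)
            ; ⁻¹-cong = neg-cong
            }
          ; comm = +-comm
          }
        ; *-cong = *-cong
        ; *-assoc = *-assoc
        ; *-identity = *-identityˡ , λ p → ≋-trans (*-comm p 1ₚ) (*-identityˡ p)
        ; distrib = distribˡ , distribʳ
        }
      ; *-comm = *-comm
      }
    }

------------------------------------------------------------------------
-- Finite sums and products

module BigOperators (R : CommutativeRing c ℓ) where
  open CommutativeRing R

  open import Algebra.Properties.Semiring.Exp semiring public using (_^_)

  ∏ : (Fin n → Carrier) → Carrier
  ∏ = RawMonoidDefs.sum *-rawMonoid

  ∑ : {A : Set} → List A → (A → Carrier) → Carrier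
  ∑ xs f = foldr _+_ 0# (map f xs)

------------------------------------------------------------------------
-- Matroids

-- The ground set is a subset of an ambient finite set Fin N, so that a matroid
-- and its minors live in the same universe.  Values of rk outside the subsets
-- of the ground set are unconstrained.
record Matroid (N : ℕ) : Set where
  field
    E          : Subset N
    rk         : Subset N → ℕ
    rk-bounded : ∀ {A} → A ⊆ E → rk A ≤ ∣ A ∣
    rk-mono    : ∀ {A B} → A ⊆ B → B ⊆ E → rk A ≤ rk B
    rk-submod  : ∀ {A B} → A ⊆ E → B ⊆ E → rk (A ∪ B) ℕ.+ rk (A ∩ B) ≤ rk A ℕ.+ rk B

open Matroid public using (E; rk)

rank : Matroid N → ℕ
rank M = rk M (E M)

corank : Matroid N → ℕ
corank M = ∣ E M ∣ ∸ rank M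

private
  ∪-⊆ : {A B C : Subset N} → A ⊆ C → B ⊆ C → A ∪ B ⊆ C
  ∪-⊆ {A = A} {B} A⊆C B⊆C x∈ = [ A⊆C , B⊆C ]′ (x∈p∪q⁻ A B x∈)

  ∪-monoʳ : (R : Subset N) {A B : Subset N} → A ⊆ B → R ∪ A ⊆ R ∪ B
  ∪-monoʳ R {A} {B} A⊆B = ∪-⊆ {A = R} {A} (p⊆p∪q {p = R} B) (λ x∈ → q⊆p∪q R B (A⊆B x∈))

  ∪-distribˡ-∪ : (R A B : Subset N) → R ∪ (A ∪ B) ≡ (R ∪ A) ∪ (R ∪ B)
  ∪-distribˡ-∪ R A B = ≡.trans (cong (_∪ (A ∪ B)) (≡.sym (∪-idem R)))
    (≡.trans (∪-assoc R R (A ∪ B))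
    (≡.trans (cong (R ∪_) (≡.trans (≡.sym (∪-assoc R A B))
                          (≡.trans (cong (_∪ B) (∪-comm R A)) (∪-assoc A R B))))
             (≡.sym (∪-assoc R A (R ∪ B)))))

-- Restriction and contraction are total: a set A not contained in the ground
-- set is replaced by E M ∩ A.
infixl 6 _∣_
_∣_ : Matroid N → Subset N → Matroid N
M ∣ A = record
  { E          = E M ∩ A
  ; rk         = rk M
  ; rk-bounded = λ B⊆ → M.rk-bounded (⊆E B⊆)
  ; rk-mono    = λ A⊆B B⊆ → M.rk-mono A⊆B (⊆E B⊆)
  ; rk-submod  = λ A⊆ B⊆ → M.rk-submod (⊆E A⊆) (⊆E B⊆)
  }
  where
  module M = Matroid M
  ⊆E : ∀ {B} → B ⊆ E M ∩ A → B ⊆ E M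
  ⊆E B⊆ x∈ = p∩q⊆p (E M) A (B⊆ x∈)

infixl 6 _/_
_/_ : Matroid N → Subset N → Matroid N
_/_ {N} M A = record
  { E          = E M ─ A
  ; rk         = λ B → rk M (R ∪ B) ∸ rk M R
  ; rk-bounded = bounded
  ; rk-mono    = λ {B} {C} B⊆C C⊆ → ℕ.∸-monoˡ-≤ (rk M R) (M.rk-mono (∪-monoʳ R B⊆C) (R∪⊆E C⊆))
  ; rk-submod  = submod
  }
  where
  module M = Matroid M

  R : Subset N
  R = E M ∩ A

  R⊆E : R ⊆ E M
  R⊆E = p∩q⊆p (E M) A

  ⊆E : ∀ {B} → B ⊆ E M ─ A → B ⊆ E M
  ⊆E B⊆ x∈ = p─q⊆p (E M) A (B⊆ x∈)

  R∪⊆E : ∀ {B} → B ⊆ E M ─ A → R ∪ B ⊆ E M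
  R∪⊆E {B} B⊆ = ∪-⊆ {A = R} {B} R⊆E (⊆E B⊆)

  bounded : ∀ {B} → B ⊆ E M ─ A → rk M (R ∪ B) ∸ rk M R ≤ ∣ B ∣
  bounded {B} B⊆ = begin
    rk M (R ∪ B) ∸ rk M R                       ≤⟨ ℕ.∸-monoˡ-≤ (rk M R) (ℕ.m≤m+n _ (rk M (R ∩ B))) ⟩
    rk M (R ∪ B) ℕ.+ rk M (R ∩ B) ∸ rk M R      ≤⟨ ℕ.∸-monoˡ-≤ (rk M R) (M.rk-submod R⊆E (⊆E B⊆)) ⟩
    rk M R ℕ.+ rk M B ∸ rk M R                  ≡⟨ ℕ.m+n∸m≡n (rk M R) (rk M B) ⟩
    rk M B                                      ≤⟨ M.rk-bounded (⊆E B⊆) ⟩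
    ∣ B ∣                                       ∎
    where open ℕ.≤-Reasoning

  R≤ : ∀ {B} → B ⊆ E M ─ A → rk M R ≤ rk M (R ∪ B)
  R≤ {B} B⊆ = M.rk-mono (p⊆p∪q {p = R} B) (R∪⊆E B⊆)

  ∸-+-∸ : ∀ {r x y} → r ≤ x → r ≤ y → (x ∸ r) ℕ.+ (y ∸ r) ≡ (x ℕ.+ y) ∸ (r ℕ.+ r)
  ∸-+-∸ {r} {x} {y} r≤x r≤y = begin
    (x ∸ r) ℕ.+ (y ∸ r)   ≡⟨ ℕ.+-∸-assoc (x ∸ r) r≤y ⟨
    (x ∸ r) ℕ.+ y ∸ r     ≡⟨ cong (_∸ r) (ℕ.+-∸-comm y r≤x) ⟨
    (x ℕ.+ y) ∸ r ∸ r     ≡⟨ ℕ.∸-+-assoc (x ℕ.+ y) r r ⟩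
    (x ℕ.+ y) ∸ (r ℕ.+ r) ∎
    where open ≡.≡-Reasoning

  submod : ∀ {B C} → B ⊆ E M ─ A → C ⊆ E M ─ A →
           (rk M (R ∪ (B ∪ C)) ∸ rk M R) ℕ.+ (rk M (R ∪ (B ∩ C)) ∸ rk M R)
           ≤ (rk M (R ∪ B) ∸ rk M R) ℕ.+ (rk M (R ∪ C) ∸ rk M R)
  submod {B} {C} B⊆ C⊆ = begin
    (rk M (R ∪ (B ∪ C)) ∸ rk M R) ℕ.+ (rk M (R ∪ (B ∩ C)) ∸ rk M R)
      ≡⟨ ∸-+-∸ (R≤ (∪-⊆ {A = B} {C} B⊆ C⊆)) (R≤ (λ x∈ → B⊆ (p∩q⊆p B C x∈))) ⟩
    (rk M (R ∪ (B ∪ C)) ℕ.+ rk M (R ∪ (B ∩ C))) ∸ (rk M R ℕ.+ rk M R)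
      ≡⟨ cong (_∸ (rk M R ℕ.+ rk M R))
           (cong₂ (λ P Q → rk M P ℕ.+ rk M Q) (∪-distribˡ-∪ R B C) (∪-distribˡ-∩ R B C)) ⟩
    (rk M ((R ∪ B) ∪ (R ∪ C)) ℕ.+ rk M ((R ∪ B) ∩ (R ∪ C))) ∸ (rk M R ℕ.+ rk M R)
      ≤⟨ ℕ.∸-monoˡ-≤ (rk M R ℕ.+ rk M R) (M.rk-submod (R∪⊆E B⊆) (R∪⊆E C⊆)) ⟩
    (rk M (R ∪ B) ℕ.+ rk M (R ∪ C)) ∸ (rk M R ℕ.+ rk M R)
      ≡⟨ ∸-+-∸ (R≤ B⊆) (R≤ C⊆) ⟨
    (rk M (R ∪ B) ∸ rk M R) ℕ.+ (rk M (R ∪ C) ∸ rk M R) ∎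
    where open ℕ.≤-Reasoning

-- All vectors with entries from xs; each occurs exactly once if xs has no repetitions.
vectors : {A : Set} → List A → ∀ k → List (Vec A k)
vectors xs zero    = [ [] ]
vectors xs (suc k) = cartesianProductWith _∷_ xs (vectors xs k)

allSubsets : ∀ N → List (Subset N)
allSubsets N = vectors (outside ∷ inside ∷ []) N

-- The truncated subtractions are genuine on subsets of E M, by the rank axioms.
tutte : (R : CommutativeRing c ℓ) → Matroid N → (x y : CommutativeRing.Carrier R) → CommutativeRing.Carrier R
tutte {N = N} R M x y =
  ∑ (filter (_⊆? E M) (allSubsets N)) λ A →
    (x - 1#) ^ (rank M ∸ rk M A) * (y - 1#) ^ (∣ A ∣ ∸ rk M A)
  where
  open CommutativeRing R
  open BigOperators R

------------------------------------------------------------------------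
-- Chains ∅ = A₀ ⊆ A₁ ⊆ ⋯ ⊆ Aₙ = E(M)

IsChain : Matroid N → ∀ n → Vec (Subset N) (suc n) → Set
IsChain M n A =
  lookup A zero ≡ ⊥ ×
  (∀ (i : Fin n) → lookup A (inject₁ i) ⊆ lookup A (suc i)) ×
  lookup A (fromℕ n) ≡ E M

isChain? : (M : Matroid N) (n : ℕ) (A : Vec (Subset N) (suc n)) → Dec (IsChain M n A)
isChain? M n A =
  Vec.≡-dec Bool._≟_ (lookup A zero) ⊥ ×-dec
  all? (λ i → lookup A (inject₁ i) ⊆? lookup A (suc i)) ×-dec
  Vec.≡-dec Bool._≟_ (lookup A (fromℕ n)) (E M)

chains : Matroid N → ∀ n → List (Vec (Subset N) (suc n))
chains {N} M n = filter (isChain? M n) (vectors (allSubsets N) (suc n))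

{-# OPTIONS --safe #-}
module Submission where

-- Write ν(A) = |A| − rk(A) and m(B) = x^(rk E − rk B) y^ν(B).  For A ⊆ C ⊆ E the factor
-- attached to a step A ⊆ C is, up to the sign (−1)^(rk C + ν(A)), the sum of
-- (−1)^|B| m(B) over A ⊆ B ⊆ C.  In a product over a chain the two signs at an
-- intermediate Aᵢ combine to (−1)^|Aᵢ|, so summing over Aᵢ is Möbius inversion on the Boolean
-- lattice, which forces the sets Bᵢ and Bᵢ₊₁ of neighbouring steps to coincide.
-- What survives is a single sum over B of ∏ᵢ mᵢ(B).

open import Defs
open import Algebra.Bundles using (CommutativeRing)
import Algebra.Properties.CommutativeSemiring.Exp as ExpProperties
import Algebra.Properties.Ring as RingProperties
import Algebra.Solver.Ring.NaturalCoefficients.Default as SemiringSolver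
import Data.Bool.Properties as Bool
open import Data.Empty using (⊥-elim)
open import Data.Fin using (Fin; zero; inject₁; suc; fromℕ; _↑ˡ_; _↑ʳ_)
open import Data.Fin.Properties using (all?)
open import Data.Fin.Subset using (Subset; inside; outside; _⊆_; _∪_; _∩_; _─_; ⊥; ∣_∣)
open import Data.Fin.Subset.Properties
  using (_⊆?_; ⊆-refl; ⊆-trans; ⊆-antisym; ⊆-min; drop-∷-⊆; out⊆; in⊆in; p∩q⊆q; x∈p∩q⁺; p⊆p∪q; x∈p∪q⁻; p─q⊆p; ∣⊥∣≡0)
open import Data.List using (List; []; _∷_; _++_; map; filter; cartesianProductWith)
open import Data.Nat using (ℕ; zero; suc; _≥_; _≤_; _∸_)
import Data.Nat as ℕ
import Data.Nat.Properties as ℕ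
open import Data.Product using (_×_; _,_; proj₂)
open import Data.Sum using ([_,_]′)
open import Data.Vec using (Vec; []; _∷_; lookup; here)
import Data.Vec.Properties as Vec
open import Function using (_∘_)
open import Level using (Level)
open import Relation.Binary.PropositionalEquality as ≡ using (_≡_; refl; cong; cong₂)
open import Relation.Nullary using (Dec; yes; no; ¬_; contradiction)
open import Relation.Nullary.Decidable using (_×-dec_)

private
  variable
    c ℓ : Level
    n N : ℕ

-- Truncated subtraction.

m∸o∸[n∸o]≡m∸n : ∀ m {n o} → o ≤ n → (m ∸ o) ∸ (n ∸ o) ≡ m ∸ n
m∸o∸[n∸o]≡m∸n m {n} {o} o≤n =
  ≡.trans (ℕ.∸-+-assoc m o (n ∸ o)) (cong (m ∸_) (ℕ.m+[n∸m]≡n o≤n))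

[m∸n]+[o∸p]≡[m+o]∸[n+p] : ∀ {m n o p} → n ≤ m → p ≤ o → (m ∸ n) ℕ.+ (o ∸ p) ≡ (m ℕ.+ o) ∸ (n ℕ.+ p)
[m∸n]+[o∸p]≡[m+o]∸[n+p] {m} {n} {o} {p} n≤m p≤o = begin
  (m ∸ n) ℕ.+ (o ∸ p)    ≡⟨ ℕ.+-∸-assoc (m ∸ n) p≤o ⟨
  (m ∸ n) ℕ.+ o ∸ p      ≡⟨ cong (_∸ p) (ℕ.+-∸-comm o n≤m) ⟨
  (m ℕ.+ o) ∸ n ∸ p      ≡⟨ ℕ.∸-+-assoc (m ℕ.+ o) n p ⟩
  (m ℕ.+ o) ∸ (n ℕ.+ p)  ∎
  where open ≡.≡-Reasoning

[m∸n]+[n∸o]≡m∸o : ∀ {m n o} → n ≤ m → o ≤ n → (m ∸ n) ℕ.+ (n ∸ o) ≡ m ∸ o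
[m∸n]+[n∸o]≡m∸o {m} {n} {o} n≤m o≤n =
  ≡.trans (≡.sym (ℕ.+-∸-assoc (m ∸ n) o≤n)) (cong (_∸ o) (ℕ.m∸n+n≡m n≤m))

-- Subsets

q⊆p⇒p∩q≡q : {p q : Subset N} → q ⊆ p → p ∩ q ≡ q
q⊆p⇒p∩q≡q {p = p} {q} q⊆p = ⊆-antisym (p∩q⊆q p q) (λ x∈q → x∈p∩q⁺ (q⊆p x∈q , x∈q))

p⊆q⇒p∪[q─p]≡q : (p q : Subset N) → p ⊆ q → p ∪ (q ─ p) ≡ q
p⊆q⇒p∪[q─p]≡q []            []            p⊆q = refl
p⊆q⇒p∪[q─p]≡q (outside ∷ p) (y ∷ q)       p⊆q = cong (y ∷_) (p⊆q⇒p∪[q─p]≡q p q (drop-∷-⊆ p⊆q))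
p⊆q⇒p∪[q─p]≡q (inside ∷ p)  (inside ∷ q)  p⊆q = cong (inside ∷_) (p⊆q⇒p∪[q─p]≡q p q (drop-∷-⊆ p⊆q))
p⊆q⇒p∪[q─p]≡q (inside ∷ p)  (outside ∷ q) p⊆q = contradiction (p⊆q here) λ ()

∪-least : {p q r : Subset N} → p ⊆ r → q ⊆ r → p ∪ q ⊆ r
∪-least {p = p} {q} p⊆r q⊆r x∈ = [ p⊆r , q⊆r ]′ (x∈p∪q⁻ p q x∈)

-- Disjointness is expressed as `q ⊆ r ─ p`, the form in which subsets of the ground set of a
-- contraction arrive.
∣p∪q∣≡∣p∣+∣q∣ : (p q r : Subset N) → q ⊆ r ─ p → ∣ p ∪ q ∣ ≡ ∣ p ∣ ℕ.+ ∣ q ∣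
∣p∪q∣≡∣p∣+∣q∣ []            []            []      q⊆ = refl
∣p∪q∣≡∣p∣+∣q∣ (outside ∷ p) (outside ∷ q) (_ ∷ r) q⊆ = ∣p∪q∣≡∣p∣+∣q∣ p q r (drop-∷-⊆ q⊆)
∣p∪q∣≡∣p∣+∣q∣ (outside ∷ p) (inside ∷ q)  (_ ∷ r) q⊆ =
  ≡.trans (cong suc (∣p∪q∣≡∣p∣+∣q∣ p q r (drop-∷-⊆ q⊆))) (≡.sym (ℕ.+-suc _ _))
∣p∪q∣≡∣p∣+∣q∣ (inside ∷ p)  (outside ∷ q) (_ ∷ r) q⊆ = cong suc (∣p∪q∣≡∣p∣+∣q∣ p q r (drop-∷-⊆ q⊆))
∣p∪q∣≡∣p∣+∣q∣ (inside ∷ p)  (inside ∷ q)  (_ ∷ r) q⊆ = contradiction (q⊆ here) λ ()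

-- Ranks of minors

module _ (M : Matroid N) where
  private module M = Matroid M

  nullity : Subset N → ℕ
  nullity A = ∣ A ∣ ∸ rk M A

  rank-/ : ∀ {A} → A ⊆ E M → rank (M / A) ≡ rank M ∸ rk M A
  rank-/ {A} A⊆E rewrite q⊆p⇒p∩q≡q A⊆E | p⊆q⇒p∪[q─p]≡q A (E M) A⊆E = refl

  corank-∣ : ∀ {A} → A ⊆ E M → corank (M ∣ A) ≡ nullity A
  corank-∣ A⊆E rewrite q⊆p⇒p∩q≡q A⊆E = refl

  module _ {A C : Subset N} (A⊆C : A ⊆ C) (C⊆E : C ⊆ E M) where

    E-minor : E (M ∣ C / A) ≡ C ─ A
    E-minor rewrite q⊆p⇒p∩q≡q C⊆E = refl

    rk-minor : ∀ B → rk (M ∣ C / A) B ≡ rk M (A ∪ B) ∸ rk M A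
    rk-minor B rewrite q⊆p⇒p∩q≡q C⊆E | q⊆p⇒p∩q≡q A⊆C = refl

    rank-minor : rank (M ∣ C / A) ≡ rk M C ∸ rk M A
    rank-minor rewrite q⊆p⇒p∩q≡q C⊆E | q⊆p⇒p∩q≡q A⊆C | p⊆q⇒p∪[q─p]≡q A C A⊆C = refl

    module _ {B : Subset N} (B⊆C─A : B ⊆ C ─ A) where
      private
        D : Subset N
        D = A ∪ B

        D⊆C : D ⊆ C
        D⊆C = ∪-least {p = A} A⊆C (λ x∈ → p─q⊆p C A (B⊆C─A x∈))

        rkA≤rkD : rk M A ≤ rk M D
        rkA≤rkD = M.rk-mono (p⊆p∪q {p = A} B) (λ x∈ → C⊆E (D⊆C x∈))

        -- Read off from the rank bound that the minor carries as a matroid, which already contains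
        -- the appeal to submodularity.
        rkD∸rkA≤∣B∣ : rk M D ∸ rk M A ≤ ∣ B ∣
        rkD∸rkA≤∣B∣ = ≡.subst (_≤ ∣ B ∣) (rk-minor B)
          (Matroid.rk-bounded (M ∣ C / A) (≡.subst (B ⊆_) (≡.sym E-minor) B⊆C─A))

      -- The `rk M A` subtracted in the contraction cancels, and the rest telescopes through
      -- `rk M C`.
      rank-exponent : (rank M ∸ rk M C) ℕ.+ (rank (M ∣ C / A) ∸ rk (M ∣ C / A) B) ≡ rank M ∸ rk M D
      rank-exponent rewrite rank-minor | rk-minor B | m∸o∸[n∸o]≡m∸n (rk M C) rkA≤rkD =
        [m∸n]+[n∸o]≡m∸o (M.rk-mono C⊆E ⊆-refl) (M.rk-mono D⊆C C⊆E)

      -- Cardinality is additive on the disjoint sets `A` and `B`, and `rk M A` plus the contracted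
      -- rank of `B` is `rk M D`. The two truncated differences may be added because neither
      -- truncates.
      nullity-exponent : nullity A ℕ.+ (∣ B ∣ ∸ rk (M ∣ C / A) B) ≡ nullity D
      nullity-exponent rewrite rk-minor B = begin
        nullity A ℕ.+ (∣ B ∣ ∸ (rk M D ∸ rk M A))
          ≡⟨ [m∸n]+[o∸p]≡[m+o]∸[n+p] (M.rk-bounded (λ x∈ → C⊆E (A⊆C x∈))) rkD∸rkA≤∣B∣ ⟩
        (∣ A ∣ ℕ.+ ∣ B ∣) ∸ (rk M A ℕ.+ (rk M D ∸ rk M A))
          ≡⟨ cong₂ _∸_ (≡.sym (∣p∪q∣≡∣p∣+∣q∣ A B C B⊆C─A)) (ℕ.m+[n∸m]≡n rkA≤rkD) ⟩
        nullity D ∎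
        where open ≡.≡-Reasoning

-- Paths A₀ ⊆ ⋯ ⊆ Aₙ in the Boolean lattice

-- Without the condition on the first set, removing that set leaves a path again, which permits
-- recursion on `n`. The conjuncts follow the order in `IsChain`, so `isChain?` is definitionally a
-- test of the first set paired with `isPath?`.
IsPath : Subset N → ∀ n → Vec (Subset N) (suc n) → Set
IsPath T n A =
  (∀ (i : Fin n) → lookup A (inject₁ i) ⊆ lookup A (suc i)) ×
  lookup A (fromℕ n) ≡ T

isPath? : (T : Subset N) (n : ℕ) (A : Vec (Subset N) (suc n)) → Dec (IsPath T n A)
isPath? T n A =
  all? (λ i → lookup A (inject₁ i) ⊆? lookup A (suc i)) ×-dec
  Vec.≡-dec Bool._≟_ (lookup A (fromℕ n)) T

module Sums (R : CommutativeRing c ℓ) where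
  open CommutativeRing R hiding (zero) renaming (refl to ≈-refl; sym to ≈-sym; trans to ≈-trans)
  open BigOperators R
  open ExpProperties commutativeSemiring using (^-homo-*; ^-congʳ; ^-congˡ; ^-distrib-*)
  open RingProperties ring using (-1*x≈-x; -‿involutive)
  open SemiringSolver commutativeSemiring using (solve; _:+_; _:*_; _:=_; con)
  open import Relation.Binary.Reasoning.Setoid setoid

  -- Finite sums

  ∑-cong : {A : Set} (xs : List A) {f g : A → Carrier} → (∀ x → f x ≈ g x) → ∑ xs f ≈ ∑ xs g
  ∑-cong []       f≈g = ≈-refl
  ∑-cong (x ∷ xs) f≈g = +-cong (f≈g x) (∑-cong xs f≈g)

  ∑-zero : {A : Set} (xs : List A) {f : A → Carrier} → (∀ x → f x ≈ 0#) → ∑ xs f ≈ 0#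
  ∑-zero []       f≈0 = ≈-refl
  ∑-zero (x ∷ xs) f≈0 = ≈-trans (+-cong (f≈0 x) (∑-zero xs f≈0)) (+-identityˡ 0#)

  ∑-distrib-+ : {A : Set} (xs : List A) (f g : A → Carrier) →
                ∑ xs (λ x → f x + g x) ≈ ∑ xs f + ∑ xs g
  ∑-distrib-+ []       f g = ≈-sym (+-identityˡ 0#)
  ∑-distrib-+ (x ∷ xs) f g = ≈-trans (+-congˡ (∑-distrib-+ xs f g))
    (solve 4 (λ x y z w → (x :+ y) :+ (z :+ w) := (x :+ z) :+ (y :+ w)) ≈-refl _ _ _ _)

  ∑-distribˡ-* : {A : Set} (xs : List A) (k : Carrier) (f : A → Carrier) →
                 k * ∑ xs f ≈ ∑ xs (λ x → k * f x)
  ∑-distribˡ-* []       k f = zeroʳ k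
  ∑-distribˡ-* (x ∷ xs) k f = ≈-trans (distribˡ k (f x) _) (+-congˡ (∑-distribˡ-* xs k f))

  ∑-comm : {A B : Set} (xs : List A) (ys : List B) (f : A → B → Carrier) →
           ∑ xs (λ x → ∑ ys (f x)) ≈ ∑ ys (λ y → ∑ xs (λ x → f x y))
  ∑-comm []       ys f = ≈-sym (∑-zero ys (λ _ → ≈-refl))
  ∑-comm (x ∷ xs) ys f = ≈-trans (+-congˡ (∑-comm xs ys f)) (≈-sym (∑-distrib-+ ys (f x) _))

  ∑-++ : {A : Set} (xs ys : List A) (f : A → Carrier) → ∑ (xs ++ ys) f ≈ ∑ xs f + ∑ ys f
  ∑-++ []       ys f = ≈-sym (+-identityˡ _)
  ∑-++ (x ∷ xs) ys f = ≈-trans (+-congˡ (∑-++ xs ys f)) (≈-sym (+-assoc _ _ _))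

  ∑-map : {A B : Set} (g : A → B) (xs : List A) (f : B → Carrier) → ∑ (map g xs) f ≈ ∑ xs (f ∘ g)
  ∑-map g []       f = ≈-refl
  ∑-map g (x ∷ xs) f = +-congˡ (∑-map g xs f)

  ∑-cartesianProductWith : {A B C : Set} (g : A → B → C) (xs : List A) (ys : List B) (f : C → Carrier) →
    ∑ (cartesianProductWith g xs ys) f ≈ ∑ xs (λ x → ∑ ys (λ y → f (g x y)))
  ∑-cartesianProductWith g []       ys f = ≈-refl
  ∑-cartesianProductWith g (x ∷ xs) ys f =
    ≈-trans (∑-++ (map (g x) ys) _ f)
            (+-cong (∑-map (g x) ys f) (∑-cartesianProductWith g xs ys f))

  -- Indicators

  𝟙 : {P : Set} → Dec P → Carrier
  𝟙 (yes _) = 1#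
  𝟙 (no  _) = 0#

  𝟙-yes : {P : Set} (d : Dec P) → P → 𝟙 d ≈ 1#
  𝟙-yes (yes _) p = ≈-refl
  𝟙-yes (no ¬p) p = contradiction p ¬p

  𝟙-no : {P : Set} (d : Dec P) → ¬ P → 𝟙 d ≈ 0#
  𝟙-no (yes p) ¬p = contradiction p ¬p
  𝟙-no (no _)  ¬p = ≈-refl

  𝟙-⇔ : {P Q : Set} (d : Dec P) (e : Dec Q) → (P → Q) → (Q → P) → 𝟙 d ≈ 𝟙 e
  𝟙-⇔ (yes p) e to from = ≈-sym (𝟙-yes e (to p))
  𝟙-⇔ (no ¬p) e to from = ≈-sym (𝟙-no e (¬p ∘ from))

  𝟙-× : {P Q : Set} (d : Dec P) (e : Dec Q) → 𝟙 (d ×-dec e) ≈ 𝟙 d * 𝟙 e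
  𝟙-× (yes _) (yes _) = ≈-sym (*-identityˡ 1#)
  𝟙-× (yes _) (no _)  = ≈-sym (zeroʳ 1#)
  𝟙-× (no _)  e       = ≈-sym (zeroˡ (𝟙 e))

  -- Lets an identity valid only under `P`, such as one that relies on rank axioms inside the ground
  -- set, be used in a sum over all subsets.
  𝟙-*-cong : {P : Set} (d : Dec P) {x y : Carrier} → (P → x ≈ y) → 𝟙 d * x ≈ 𝟙 d * y
  𝟙-*-cong (yes p) x≈y = *-congˡ (x≈y p)
  𝟙-*-cong (no _)  x≈y = ≈-trans (zeroˡ _) (≈-sym (zeroˡ _))

  -- With the condition moved into an indicator, the range of a sum no longer depends on other sets,
  -- so sums can be interchanged freely.
  ∑-filter : {A : Set} {P : A → Set} (P? : ∀ x → Dec (P x)) (xs : List A) (f : A → Carrier) →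
             ∑ (filter P? xs) f ≈ ∑ xs (λ x → 𝟙 (P? x) * f x)
  ∑-filter P? []       f = ≈-refl
  ∑-filter P? (x ∷ xs) f with P? x
  ... | yes _ = +-cong (≈-sym (*-identityˡ (f x))) (∑-filter P? xs f)
  ... | no  _ = ≈-trans (∑-filter P? xs f) (≈-sym (≈-trans (+-congʳ (zeroˡ (f x))) (+-identityˡ _)))

  -- Signs

  ε : ℕ → Carrier
  ε k = (- 1#) ^ k

  ε-+ : ∀ m n → ε (m ℕ.+ n) ≈ ε m * ε n
  ε-+ = ^-homo-* (- 1#)

  ε²≈1 : ∀ k → ε k * ε k ≈ 1#
  ε²≈1 zero    = *-identityˡ 1#
  ε²≈1 (suc k) = begin
    (- 1# * ε k) * (- 1# * ε k)    ≈⟨ solve 2 (λ m e → (m :* e) :* (m :* e) := (m :* m) :* (e :* e)) ≈-refl _ _ ⟩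
    (- 1# * - 1#) * (ε k * ε k)    ≈⟨ *-cong (≈-trans (-1*x≈-x (- 1#)) (-‿involutive 1#)) (ε²≈1 k) ⟩
    1# * 1#                        ≈⟨ *-identityˡ 1# ⟩
    1#                             ∎

  -- Signs are their own inverses, so a difference of exponents has the sign of the sum.
  ε-∸ : ∀ {m n} → n ≤ m → ε (m ∸ n) ≈ ε m * ε n
  ε-∸ {m} {n} n≤m = begin
    ε (m ∸ n)                      ≈⟨ *-identityʳ _ ⟨
    ε (m ∸ n) * 1#                 ≈⟨ *-congˡ (ε²≈1 n) ⟨
    ε (m ∸ n) * (ε n * ε n)        ≈⟨ *-assoc _ _ _ ⟨
    ε (m ∸ n) * ε n * ε n          ≈⟨ *-congʳ (ε-+ (m ∸ n) n) ⟨
    ε (m ∸ n ℕ.+ n) * ε n          ≈⟨ *-congʳ (^-congʳ (- 1#) (ℕ.m∸n+n≡m n≤m)) ⟩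
    ε m * ε n                      ∎

  [1-x-1]^k≈εx^k : ∀ x k → (1# - x - 1#) ^ k ≈ ε k * x ^ k
  [1-x-1]^k≈εx^k x k = begin
    (1# - x - 1#) ^ k      ≈⟨ ^-congˡ k (+-congʳ (+-comm 1# (- x))) ⟩
    (- x + 1# - 1#) ^ k    ≈⟨ ^-congˡ k (+-assoc (- x) 1# (- 1#)) ⟩
    (- x + (1# - 1#)) ^ k  ≈⟨ ^-congˡ k (+-congˡ (-‿inverseʳ 1#)) ⟩
    (- x + 0#) ^ k         ≈⟨ ^-congˡ k (+-identityʳ (- x)) ⟩
    (- x) ^ k              ≈⟨ ^-congˡ k (-1*x≈-x x) ⟨
    (- 1# * x) ^ k         ≈⟨ ^-distrib-* (- 1#) x k ⟩
    ε k * x ^ k            ∎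

  -- Sums over the Boolean lattice

  -- The zeta function of the Boolean lattice.
  ζ : Subset N → Subset N → Carrier
  ζ A B = 𝟙 (A ⊆? B)

  ζ-out : (A B : Subset N) → ∀ y → ζ (outside ∷ A) (y ∷ B) ≈ ζ A B
  ζ-out A B y = 𝟙-⇔ ((outside ∷ A) ⊆? (y ∷ B)) (A ⊆? B) drop-∷-⊆ out⊆

  ζ-in-in : (A B : Subset N) → ζ (inside ∷ A) (inside ∷ B) ≈ ζ A B
  ζ-in-in A B = 𝟙-⇔ ((inside ∷ A) ⊆? (inside ∷ B)) (A ⊆? B) drop-∷-⊆ in⊆in

  ζ-in-out : (A B : Subset N) → ζ (inside ∷ A) (outside ∷ B) ≈ 0#
  ζ-in-out A B = 𝟙-no ((inside ∷ A) ⊆? (outside ∷ B)) (λ A⊆B → contradiction (A⊆B here) λ ())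

  ζ-empty : {A C : Subset N} → ¬ A ⊆ C → ∀ B → ζ A B * ζ B C ≈ 0#
  ζ-empty {A = A} {C} A⊈C B with A ⊆? B | B ⊆? C
  ... | yes A⊆B | yes B⊆C = ⊥-elim (A⊈C (⊆-trans A⊆B B⊆C))
  ... | yes _   | no  _   = zeroʳ 1#
  ... | no  _   | yes _   = zeroˡ 1#
  ... | no  _   | no  _   = zeroˡ 0#

  ∑₂ : (Subset N → Carrier) → Carrier
  ∑₂ {N} = ∑ (allSubsets N)

  ∑₂-suc : (f : Subset (suc N) → Carrier) → ∑₂ f ≈ ∑₂ (f ∘ (outside ∷_)) + ∑₂ (f ∘ (inside ∷_))
  ∑₂-suc {N} f = ≈-trans
    (∑-cartesianProductWith _∷_ (outside ∷ inside ∷ []) (allSubsets N) f) (+-congˡ (+-identityʳ _))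

  ∑↑ : Subset N → (Subset N → Carrier) → Carrier
  ∑↑ A f = ∑₂ λ B → ζ A B * f B

  ∑↓ : Subset N → (Subset N → Carrier) → Carrier
  ∑↓ B f = ∑₂ λ A → ζ A B * f A

  ∑↑-cong : (A : Subset N) {f g : Subset N → Carrier} → (∀ B → f B ≈ g B) → ∑↑ A f ≈ ∑↑ A g
  ∑↑-cong {N} A f≈g = ∑-cong (allSubsets N) (λ B → *-congˡ (f≈g B))

  ∑↑-distribˡ-* : (A : Subset N) (k : Carrier) (f : Subset N → Carrier) →
                  k * ∑↑ A f ≈ ∑↑ A (λ B → k * f B)
  ∑↑-distribˡ-* {N} A k f = ≈-trans (∑-distribˡ-* (allSubsets N) k _)
    (∑-cong (allSubsets N) (λ B → solve 3 (λ x y z → x :* (y :* z) := y :* (x :* z)) ≈-refl _ _ _))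

  ∑↑-out : (A : Subset N) (f : Subset (suc N) → Carrier) →
           ∑↑ (outside ∷ A) f ≈ ∑↑ A (f ∘ (outside ∷_)) + ∑↑ A (f ∘ (inside ∷_))
  ∑↑-out {N} A f = ≈-trans (∑₂-suc (λ B → ζ (outside ∷ A) B * f B))
    (+-cong (∑-cong (allSubsets N) (λ B → *-congʳ (ζ-out A B outside)))
            (∑-cong (allSubsets N) (λ B → *-congʳ (ζ-out A B inside))))

  ∑↑-in : (A : Subset N) (f : Subset (suc N) → Carrier) → ∑↑ (inside ∷ A) f ≈ ∑↑ A (f ∘ (inside ∷_))
  ∑↑-in {N} A f = ≈-trans (∑₂-suc (λ B → ζ (inside ∷ A) B * f B)) (≈-trans
    (+-cong (∑-zero (allSubsets N) (λ B → ≈-trans (*-congʳ (ζ-in-out A B)) (zeroˡ _)))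
            (∑-cong (allSubsets N) (λ B → *-congʳ (ζ-in-in A B))))
    (+-identityˡ _))

  ∑↓-out : (B : Subset N) (f : Subset (suc N) → Carrier) → ∑↓ (outside ∷ B) f ≈ ∑↓ B (f ∘ (outside ∷_))
  ∑↓-out {N} B f = ≈-trans (∑₂-suc (λ A → ζ A (outside ∷ B) * f A)) (≈-trans
    (+-cong (∑-cong (allSubsets N) (λ A → *-congʳ (ζ-out A B outside)))
            (∑-zero (allSubsets N) (λ A → ≈-trans (*-congʳ (ζ-in-out A B)) (zeroˡ _))))
    (+-identityʳ _))

  ∑↓-in : (B : Subset N) (f : Subset (suc N) → Carrier) →
          ∑↓ (inside ∷ B) f ≈ ∑↓ B (f ∘ (outside ∷_)) + ∑↓ B (f ∘ (inside ∷_))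
  ∑↓-in {N} B f = ≈-trans (∑₂-suc (λ A → ζ A (inside ∷ B) * f A))
    (+-cong (∑-cong (allSubsets N) (λ A → *-congʳ (ζ-out A B inside)))
            (∑-cong (allSubsets N) (λ A → *-congʳ (ζ-in-in A B))))

  -- Möbius inversion in involutive form: sending `f` to `ε ∣ A ∣ * ∑↑ A f` is its own inverse. The
  -- induction is on the ambient set. If the first element is not in `B`, the sets `A` with and
  -- without it carry opposite signs, and only the values of `f` on sets avoiding it survive. If it
  -- is in `B`, it contributes a common factor `- 1#`.
  möbius : (B : Subset N) (f : Subset N → Carrier) → ∑↑ B (λ A → ε ∣ A ∣ * ∑↑ A f) ≈ ε ∣ B ∣ * f B
  möbius []            f =
    solve 1 (λ x → con 1 :* (con 1 :* (con 1 :* x :+ con 0)) :+ con 0 := con 1 :* x) ≈-refl (f [])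
  möbius {suc N} (outside ∷ B) f = begin
    ∑↑ (outside ∷ B) (λ A → ε ∣ A ∣ * ∑↑ A f)
      ≈⟨ ∑↑-out B _ ⟩
    ∑↑ B (λ A → ε ∣ A ∣ * ∑↑ (outside ∷ A) f) + ∑↑ B (λ A → (- 1# * ε ∣ A ∣) * ∑↑ (inside ∷ A) f)
      ≈⟨ ∑-distrib-+ (allSubsets N) _ _ ⟨
    ∑₂ (λ A → ζ B A * (ε ∣ A ∣ * ∑↑ (outside ∷ A) f) + ζ B A * ((- 1# * ε ∣ A ∣) * ∑↑ (inside ∷ A) f))
      ≈⟨ ∑-cong (allSubsets N) cancel ⟩
    ∑↑ B (λ A → ε ∣ A ∣ * ∑↑ A (f ∘ (outside ∷_)))
      ≈⟨ möbius B (f ∘ (outside ∷_)) ⟩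
    ε ∣ B ∣ * f (outside ∷ B) ∎
    where
    cancel : ∀ A → ζ B A * (ε ∣ A ∣ * ∑↑ (outside ∷ A) f) + ζ B A * ((- 1# * ε ∣ A ∣) * ∑↑ (inside ∷ A) f)
                   ≈ ζ B A * (ε ∣ A ∣ * ∑↑ A (f ∘ (outside ∷_)))
    cancel A = begin
      z * (e * ∑↑ (outside ∷ A) f) + z * ((- 1# * e) * ∑↑ (inside ∷ A) f)
        ≈⟨ +-cong (*-congˡ (*-congˡ (∑↑-out A f))) (*-congˡ (*-congˡ (∑↑-in A f))) ⟩
      z * (e * (u + v)) + z * ((- 1# * e) * v)
        -- Here `- 1#` is the indeterminate `m`; that `1# + m` vanishes is used in the next step.
        ≈⟨ solve 5 (λ z e u v m → z :* (e :* (u :+ v)) :+ z :* ((m :* e) :* v)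
                                  := z :* (e :* u) :+ (con 1 :+ m) :* (z :* (e :* v))) ≈-refl z e u v (- 1#) ⟩
      z * (e * u) + (1# - 1#) * (z * (e * v))
        ≈⟨ +-congˡ (≈-trans (*-congʳ (-‿inverseʳ 1#)) (zeroˡ _)) ⟩
      z * (e * u) + 0#
        ≈⟨ +-identityʳ _ ⟩
      z * (e * u) ∎
      where
      z = ζ B A
      e = ε ∣ A ∣
      u = ∑↑ A (f ∘ (outside ∷_))
      v = ∑↑ A (f ∘ (inside ∷_))
  möbius (inside ∷ B) f = begin
    ∑↑ (inside ∷ B) (λ A → ε ∣ A ∣ * ∑↑ A f)
      ≈⟨ ∑↑-in B _ ⟩
    ∑↑ B (λ A → (- 1# * ε ∣ A ∣) * ∑↑ (inside ∷ A) f)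
      ≈⟨ ∑↑-cong B (λ A → ≈-trans (*-congˡ (∑↑-in A f)) (*-assoc _ _ _)) ⟩
    ∑↑ B (λ A → - 1# * (ε ∣ A ∣ * ∑↑ A (f ∘ (inside ∷_))))
      ≈⟨ ∑↑-distribˡ-* B (- 1#) _ ⟨
    - 1# * ∑↑ B (λ A → ε ∣ A ∣ * ∑↑ A (f ∘ (inside ∷_)))
      ≈⟨ *-congˡ (möbius B (f ∘ (inside ∷_))) ⟩
    - 1# * (ε ∣ B ∣ * f (inside ∷ B))
      ≈⟨ *-assoc _ _ _ ⟨
    (- 1# * ε ∣ B ∣) * f (inside ∷ B) ∎

  -- Sums over intervals.

  ∑↑↓ : Subset N → Subset N → (Subset N → Carrier) → Carrier
  ∑↑↓ A C f = ∑↑ A λ B → ζ B C * f B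

  ∑↑↓-empty : {A C : Subset N} → ¬ A ⊆ C → ∀ f → ∑↑↓ A C f ≈ 0#
  ∑↑↓-empty {N} A⊈C f = ∑-zero (allSubsets N) λ B →
    ≈-trans (≈-sym (*-assoc _ _ _)) (≈-trans (*-congʳ (ζ-empty A⊈C B)) (zeroˡ _))

  -- Union with `A` carries the subsets of `C ─ A` bijectively onto the interval from `A` to `C`.
  -- Position by position, both sums branch exactly at the elements of `C` outside `A`; elsewhere
  -- membership is forced.
  ∑↓-─ : (A C : Subset N) → A ⊆ C → (f : Subset N → Carrier) →
         ∑↓ (C ─ A) (λ B → f (A ∪ B)) ≈ ∑↑↓ A C f
  ∑↓-─ [] [] _ f =
    solve 1 (λ x → con 1 :* x :+ con 0 := con 1 :* (con 1 :* x) :+ con 0) ≈-refl (f [])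
  ∑↓-─ {suc N} (outside ∷ A) (outside ∷ C) A⊆C f = begin
    ∑↓ (outside ∷ (C ─ A)) (λ B → f ((outside ∷ A) ∪ B))
      ≈⟨ ∑↓-out (C ─ A) _ ⟩
    ∑↓ (C ─ A) (λ B → f (outside ∷ (A ∪ B)))
      ≈⟨ ∑↓-─ A C (drop-∷-⊆ A⊆C) _ ⟩
    ∑↑↓ A C (f ∘ (outside ∷_))
      ≈⟨ +-identityʳ _ ⟨
    ∑↑↓ A C (f ∘ (outside ∷_)) + 0#
      ≈⟨ +-cong (∑↑-cong A (λ B → *-congʳ (≈-sym (ζ-out B C outside))))
                (≈-sym (∑-zero (allSubsets N) λ B →
                  ≈-trans (*-congˡ (≈-trans (*-congʳ (ζ-in-out B C)) (zeroˡ _))) (zeroʳ _))) ⟩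
    ∑↑ A (λ B → ζ (outside ∷ B) (outside ∷ C) * f (outside ∷ B)) +
    ∑↑ A (λ B → ζ (inside ∷ B) (outside ∷ C) * f (inside ∷ B))
      ≈⟨ ∑↑-out A _ ⟨
    ∑↑↓ (outside ∷ A) (outside ∷ C) f ∎
  ∑↓-─ (outside ∷ A) (inside ∷ C) A⊆C f = begin
    ∑↓ (inside ∷ (C ─ A)) (λ B → f ((outside ∷ A) ∪ B))
      ≈⟨ ∑↓-in (C ─ A) _ ⟩
    ∑↓ (C ─ A) (λ B → f (outside ∷ (A ∪ B))) + ∑↓ (C ─ A) (λ B → f (inside ∷ (A ∪ B)))
      ≈⟨ +-cong (∑↓-─ A C (drop-∷-⊆ A⊆C) _) (∑↓-─ A C (drop-∷-⊆ A⊆C) _) ⟩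
    ∑↑↓ A C (f ∘ (outside ∷_)) + ∑↑↓ A C (f ∘ (inside ∷_))
      ≈⟨ +-cong (∑↑-cong A (λ B → *-congʳ (ζ-out B C inside)))
                (∑↑-cong A (λ B → *-congʳ (ζ-in-in B C))) ⟨
    ∑↑ A (λ B → ζ (outside ∷ B) (inside ∷ C) * f (outside ∷ B)) +
    ∑↑ A (λ B → ζ (inside ∷ B) (inside ∷ C) * f (inside ∷ B))
      ≈⟨ ∑↑-out A _ ⟨
    ∑↑↓ (outside ∷ A) (inside ∷ C) f ∎
  ∑↓-─ (inside ∷ A) (inside ∷ C) A⊆C f = begin
    ∑↓ (outside ∷ (C ─ A)) (λ B → f ((inside ∷ A) ∪ B))
      ≈⟨ ∑↓-out (C ─ A) _ ⟩
    ∑↓ (C ─ A) (λ B → f (inside ∷ (A ∪ B)))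
      ≈⟨ ∑↓-─ A C (drop-∷-⊆ A⊆C) _ ⟩
    ∑↑↓ A C (f ∘ (inside ∷_))
      ≈⟨ ∑↑-cong A (λ B → *-congʳ (ζ-in-in B C)) ⟨
    ∑↑ A (λ B → ζ (inside ∷ B) (inside ∷ C) * f (inside ∷ B))
      ≈⟨ ∑↑-in A _ ⟨
    ∑↑↓ (inside ∷ A) (inside ∷ C) f ∎
  ∑↓-─ (inside ∷ A) (outside ∷ C) A⊆C f = contradiction (A⊆C here) λ ()

  -- This rests on `allSubsets` listing `T` exactly once: at each position only the matching head
  -- contributes.
  ∑₂-δ : (T : Subset N) (f : Subset N → Carrier) → ∑₂ (λ S → 𝟙 (Vec.≡-dec Bool._≟_ S T) * f S) ≈ f T
  ∑₂-δ {zero}  []      f = solve 1 (λ x → con 1 :* x :+ con 0 := x) ≈-refl (f [])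
  ∑₂-δ {suc N} (t ∷ T) f = ≈-trans (∑₂-suc (λ S → 𝟙 (S ≟ (t ∷ T)) * f S)) (split t)
    where
    _≟_ : ∀ {N} (A B : Subset N) → Dec (A ≡ B)
    _≟_ = Vec.≡-dec Bool._≟_

    same : ∀ t → ∑₂ (λ S → 𝟙 ((t ∷ S) ≟ (t ∷ T)) * f (t ∷ S)) ≈ f (t ∷ T)
    same t = ≈-trans
      (∑-cong (allSubsets N) λ S →
        *-congʳ (𝟙-⇔ ((t ∷ S) ≟ (t ∷ T)) (S ≟ T) Vec.∷-injectiveʳ (cong (t ∷_))))
      (∑₂-δ T (f ∘ (t ∷_)))

    different : ∀ s t → ¬ s ≡ t → ∑₂ (λ S → 𝟙 ((s ∷ S) ≟ (t ∷ T)) * f (s ∷ S)) ≈ 0#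
    different s t s≢t = ∑-zero (allSubsets N) λ S →
      ≈-trans (*-congʳ (𝟙-no ((s ∷ S) ≟ (t ∷ T)) (s≢t ∘ Vec.∷-injectiveˡ))) (zeroˡ _)

    split : ∀ t → ∑₂ (λ S → 𝟙 ((outside ∷ S) ≟ (t ∷ T)) * f (outside ∷ S)) +
                  ∑₂ (λ S → 𝟙 ((inside ∷ S) ≟ (t ∷ T)) * f (inside ∷ S)) ≈ f (t ∷ T)
    split outside = ≈-trans (+-cong (same outside) (different inside outside λ ())) (+-identityʳ _)
    split inside  = ≈-trans (+-cong (different outside inside λ ()) (same inside)) (+-identityˡ _)

  -- Interchange of summation: for fixed `B` above `S`, the set `A` ranges over all sets above `B`.
  -- This exposes an inner upward sum of the kind that `möbius` evaluates.
  ∑₂-∑↑↓ : (S : Subset N) (f g : Subset N → Carrier) →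
           ∑₂ (λ A → ∑↑↓ S A f * g A) ≈ ∑↑ S (λ B → f B * ∑↑ B g)
  ∑₂-∑↑↓ {N} S f g = begin
    ∑₂ (λ A → ∑↑↓ S A f * g A)
      ≈⟨ ∑-cong (allSubsets N) (λ A → ≈-trans (*-comm _ _) (∑-distribˡ-* (allSubsets N) (g A) _)) ⟩
    ∑₂ (λ A → ∑₂ (λ B → g A * (ζ S B * (ζ B A * f B))))
      ≈⟨ ∑-comm (allSubsets N) (allSubsets N) _ ⟩
    ∑₂ (λ B → ∑₂ (λ A → g A * (ζ S B * (ζ B A * f B))))
      ≈⟨ ∑-cong (allSubsets N) (λ B → ∑-cong (allSubsets N) (λ A →
           solve 4 (λ g s z f → g :* (s :* (z :* f)) := (s :* f) :* (z :* g)) ≈-refl _ _ _ _)) ⟩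
    ∑₂ (λ B → ∑₂ (λ A → (ζ S B * f B) * (ζ B A * g A)))
      ≈⟨ ∑-cong (allSubsets N) (λ B → ≈-trans (≈-sym (∑-distribˡ-* (allSubsets N) _ _)) (*-assoc _ _ _)) ⟩
    ∑↑ S (λ B → f B * ∑↑ B g) ∎

  -- Sums over chains

  weight : (u : Fin n → Subset N → Subset N → Carrier) → Vec (Subset N) (suc n) → Carrier
  weight u A = ∏ λ i → u i (lookup A (inject₁ i)) (lookup A (suc i))

  -- The `(S , T)` entry of the product of the `n` matrices with entries `ζ A C * u i A C`, a
  -- product in the incidence algebra; the base case is the identity matrix.
  pathSum : ∀ n → (Fin n → Subset N → Subset N → Carrier) → Subset N → Subset N → Carrier
  pathSum zero    u T S = 𝟙 (Vec.≡-dec Bool._≟_ S T)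
  pathSum (suc n) u T S = ∑↑ S λ A → u zero S A * pathSum n (u ∘ suc) T A

  𝟙-isPath?-∷ : (T S A : Subset N) (v : Vec (Subset N) n) →
                𝟙 (isPath? T (suc n) (S ∷ A ∷ v)) ≈ ζ S A * 𝟙 (isPath? T n (A ∷ v))
  𝟙-isPath?-∷ {n = n} T S A v = ≈-trans
    (𝟙-⇔ (isPath? T (suc n) (S ∷ A ∷ v)) ((S ⊆? A) ×-dec isPath? T n (A ∷ v))
      (λ (steps , end) → (λ {x} → steps zero {x}) , (λ i {x} → steps (suc i) {x}) , end)
      (λ (step , steps , end) → (λ { zero {x} → step {x} ; (suc i) {x} → steps i {x} }) , end))
    (𝟙-× (S ⊆? A) (isPath? T n (A ∷ v)))

  ∑-paths : ∀ n (u : Fin n → Subset N → Subset N → Carrier) (T S : Subset N) →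
            ∑ (vectors (allSubsets N) n) (λ v → 𝟙 (isPath? T n (S ∷ v)) * weight u (S ∷ v)) ≈ pathSum n u T S
  ∑-paths zero    u T S = begin
    𝟙 (isPath? T 0 (S ∷ [])) * 1# + 0#   ≈⟨ solve 1 (λ x → x :* con 1 :+ con 0 := x) ≈-refl _ ⟩
    𝟙 (isPath? T 0 (S ∷ []))             ≈⟨ 𝟙-⇔ (isPath? T 0 (S ∷ [])) (Vec.≡-dec Bool._≟_ S T) proj₂ (λ S≡T → (λ ()) , S≡T) ⟩
    𝟙 (Vec.≡-dec Bool._≟_ S T)           ∎
  ∑-paths {N} (suc n) u T S = begin
    ∑ (vectors (allSubsets N) (suc n)) (λ v → 𝟙 (isPath? T (suc n) (S ∷ v)) * weight u (S ∷ v))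
      ≈⟨ ∑-cartesianProductWith _∷_ (allSubsets N) (vectors (allSubsets N) n) _ ⟩
    ∑₂ (λ A → ∑ (vectors (allSubsets N) n) (λ v →
      𝟙 (isPath? T (suc n) (S ∷ A ∷ v)) * (u zero S A * weight (u ∘ suc) (A ∷ v))))
      ≈⟨ ∑-cong (allSubsets N) (λ A → ∑-cong (vectors (allSubsets N) n) (λ v → ≈-trans
           (*-congʳ (𝟙-isPath?-∷ T S A v))
           (solve 4 (λ z p u w → (z :* p) :* (u :* w) := (z :* u) :* (p :* w)) ≈-refl _ _ _ _))) ⟩
    ∑₂ (λ A → ∑ (vectors (allSubsets N) n) (λ v →
      (ζ S A * u zero S A) * (𝟙 (isPath? T n (A ∷ v)) * weight (u ∘ suc) (A ∷ v))))
      ≈⟨ ∑-cong (allSubsets N) (λ A → ≈-trans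
           (≈-sym (∑-distribˡ-* (vectors (allSubsets N) n) _ _))
           (≈-trans (*-congˡ (∑-paths n (u ∘ suc) T A)) (*-assoc _ _ _))) ⟩
    pathSum (suc n) u T S ∎

  ∑-chains : (M : Matroid N) → ∀ n (u : Fin n → Subset N → Subset N → Carrier) →
             ∑ (chains M n) (weight u) ≈ pathSum n u (E M) ⊥
  ∑-chains {N} M n u = begin
    ∑ (chains M n) (weight u)
      ≈⟨ ∑-filter (isChain? M n) (vectors (allSubsets N) (suc n)) (weight u) ⟩
    ∑ (vectors (allSubsets N) (suc n)) (λ A → 𝟙 (isChain? M n A) * weight u A)
      ≈⟨ ∑-cartesianProductWith _∷_ (allSubsets N) (vectors (allSubsets N) n) _ ⟩
    ∑₂ (λ S → ∑ (vectors (allSubsets N) n) (λ v → 𝟙 (isChain? M n (S ∷ v)) * weight u (S ∷ v)))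
      ≈⟨ ∑-cong (allSubsets N) (λ S → ∑-cong (vectors (allSubsets N) n) (λ v → ≈-trans
           -- The test of the first set against `⊥` splits off, so that `∑₂-δ` can later evaluate
           -- the sum over `S`.
           (*-congʳ (𝟙-× (Vec.≡-dec Bool._≟_ S ⊥) (isPath? (E M) n (S ∷ v)))) (*-assoc _ _ _))) ⟩
    ∑₂ (λ S → ∑ (vectors (allSubsets N) n) (λ v →
      𝟙 (Vec.≡-dec Bool._≟_ S ⊥) * (𝟙 (isPath? (E M) n (S ∷ v)) * weight u (S ∷ v))))
      ≈⟨ ∑-cong (allSubsets N) (λ S → ≈-trans
           (≈-sym (∑-distribˡ-* (vectors (allSubsets N) n) _ _)) (*-congˡ (∑-paths n u (E M) S))) ⟩
    ∑₂ (λ S → 𝟙 (Vec.≡-dec Bool._≟_ S ⊥) * pathSum n u (E M) S)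
      ≈⟨ ∑₂-δ ⊥ (pathSum n u (E M)) ⟩
    pathSum n u (E M) ⊥ ∎

  -- The convolution formula

  monomial : Matroid N → (x y : Carrier) → Subset N → Carrier
  monomial M x y B = x ^ (rank M ∸ rk M B) * y ^ nullity M B

  -- Both bases become negatives, `- x` and `- y`. The exponents of the two signs each involve
  -- `rk M A`; these two contributions cancel, leaving the constant `ε (rank M)` and the Möbius sign
  -- `ε ∣ A ∣`.
  tutte-signed : (M : Matroid N) (x y : Carrier) →
    tutte R M (1# - x) (1# - y) ≈ ε (rank M) * ∑↓ (E M) (λ A → ε ∣ A ∣ * monomial M x y A)
  tutte-signed {N} M x y = begin
    tutte R M (1# - x) (1# - y)
      ≈⟨ ∑-filter (_⊆? E M) (allSubsets N) _ ⟩
    ∑↓ (E M) (λ A → (1# - x - 1#) ^ (rank M ∸ rk M A) * (1# - y - 1#) ^ nullity M A)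
      ≈⟨ ∑-cong (allSubsets N) (λ A → ≈-trans (𝟙-*-cong (A ⊆? E M) (signs A))
           (solve 3 (λ z r t → z :* (r :* t) := r :* (z :* t)) ≈-refl _ _ _)) ⟩
    ∑₂ (λ A → ε (rank M) * (ζ A (E M) * (ε ∣ A ∣ * monomial M x y A)))
      ≈⟨ ∑-distribˡ-* (allSubsets N) _ _ ⟨
    ε (rank M) * ∑↓ (E M) (λ A → ε ∣ A ∣ * monomial M x y A) ∎
    where
    signs : ∀ A → A ⊆ E M → (1# - x - 1#) ^ (rank M ∸ rk M A) * (1# - y - 1#) ^ nullity M A
                            ≈ ε (rank M) * (ε ∣ A ∣ * monomial M x y A)
    signs A A⊆E = begin
      (1# - x - 1#) ^ p * (1# - y - 1#) ^ q
        ≈⟨ *-cong ([1-x-1]^k≈εx^k x p) ([1-x-1]^k≈εx^k y q) ⟩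
      (ε p * x ^ p) * (ε q * y ^ q)
        ≈⟨ *-cong (*-congʳ (ε-∸ (Matroid.rk-mono M A⊆E ⊆-refl))) (*-congʳ (ε-∸ (Matroid.rk-bounded M A⊆E))) ⟩
      ((ε (rank M) * ε (rk M A)) * x ^ p) * ((ε ∣ A ∣ * ε (rk M A)) * y ^ q)
        ≈⟨ solve 5 (λ r s x a y → ((r :* s) :* x) :* ((a :* s) :* y) := (r :* (a :* (x :* y))) :* (s :* s))
             ≈-refl _ _ _ _ _ ⟩
      (ε (rank M) * (ε ∣ A ∣ * (x ^ p * y ^ q))) * (ε (rk M A) * ε (rk M A))
        ≈⟨ ≈-trans (*-congˡ (ε²≈1 (rk M A))) (*-identityʳ _) ⟩
      ε (rank M) * (ε ∣ A ∣ * (x ^ p * y ^ q)) ∎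
      where
      p = rank M ∸ rk M A
      q = nullity M A

  ε-nullity : (M : Matroid N) → ∀ {A} → A ⊆ E M → ε (nullity M A) ≈ ε ∣ A ∣ * ε (rk M A)
  ε-nullity M A⊆E = ε-∸ (Matroid.rk-bounded M A⊆E)

  minorWeight : Matroid N → (x y : Carrier) → Subset N → Subset N → Carrier
  minorWeight M x y A C = x ^ rank (M / C) * y ^ corank (M ∣ A) * tutte R (M ∣ C / A) (1# - x) (1# - y)

  -- The prefactor supplies exactly the powers that turn a term of the minor at `B` into the
  -- monomial of `M` at `A ∪ B`, so the weight becomes an interval sum that refers to `M` alone. The
  -- sign factors into a part depending on `C` and a part depending on `A`, as is needed to
  -- recombine signs at a set shared by two steps.
  minorWeight-signed : (M : Matroid N) (x y : Carrier) → ∀ {A C} → A ⊆ C → C ⊆ E M →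
    minorWeight M x y A C
      ≈ ε (rk M C) * (ε (nullity M A) * ∑↑↓ A C (λ B → ε ∣ B ∣ * monomial M x y B))
  minorWeight-signed {N} M x y {A} {C} A⊆C C⊆E = begin
    k * tutte R M′ (1# - x) (1# - y)
      ≈⟨ *-congˡ (tutte-signed M′ x y) ⟩
    k * (ε (rank M′) * ∑↓ (E M′) (λ B → ε ∣ B ∣ * monomial M′ x y B))
      ≈⟨ solve 3 (λ k r s → k :* (r :* s) := r :* (k :* s)) ≈-refl _ _ _ ⟩
    ε (rank M′) * (k * ∑↓ (E M′) (λ B → ε ∣ B ∣ * monomial M′ x y B))
      ≈⟨ *-cong (≈-trans (^-congʳ (- 1#) (rank-minor M A⊆C C⊆E)) (ε-∸ (Matroid.rk-mono M A⊆C C⊆E))) sums ⟩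
    (ε (rk M C) * ε (rk M A)) * (ε ∣ A ∣ * S)
      ≈⟨ solve 4 (λ c r a s → (c :* r) :* (a :* s) := c :* ((a :* r) :* s)) ≈-refl _ _ _ _ ⟩
    ε (rk M C) * ((ε ∣ A ∣ * ε (rk M A)) * S)
      ≈⟨ *-congˡ (*-congʳ (ε-nullity M A⊆E)) ⟨
    ε (rk M C) * (ε (nullity M A) * S) ∎
    where
    M′ = M ∣ C / A
    k = x ^ rank (M / C) * y ^ corank (M ∣ A)
    S = ∑↑↓ A C (λ B → ε ∣ B ∣ * monomial M x y B)

    A⊆E : A ⊆ E M
    A⊆E x∈ = C⊆E (A⊆C x∈)

    term : ∀ B → B ⊆ C ─ A →
           k * (ε ∣ B ∣ * monomial M′ x y B) ≈ ε ∣ A ∣ * (ε ∣ A ∪ B ∣ * monomial M x y (A ∪ B))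
    term B B⊆ = begin
      (x ^ r * y ^ s) * (ε ∣ B ∣ * (x ^ p * y ^ q))
        ≈⟨ solve 5 (λ xr ys e xp yq → (xr :* ys) :* (e :* (xp :* yq)) := e :* ((xr :* xp) :* (ys :* yq)))
             ≈-refl _ _ _ _ _ ⟩
      ε ∣ B ∣ * ((x ^ r * x ^ p) * (y ^ s * y ^ q))
        ≈⟨ *-congˡ (*-cong (^-homo-* x r p) (^-homo-* y s q)) ⟨
      ε ∣ B ∣ * (x ^ (r ℕ.+ p) * y ^ (s ℕ.+ q))
        ≈⟨ *-congˡ (*-cong
             (^-congʳ x (≡.trans (cong (ℕ._+ p) (rank-/ M C⊆E)) (rank-exponent M A⊆C C⊆E B⊆)))
             (^-congʳ y (≡.trans (cong (ℕ._+ q) (corank-∣ M A⊆E)) (nullity-exponent M A⊆C C⊆E B⊆)))) ⟩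
      ε ∣ B ∣ * m
        ≈⟨ *-identityˡ _ ⟨
      1# * (ε ∣ B ∣ * m)
        -- A square of `ε ∣ A ∣` is inserted: one copy completes `ε ∣ B ∣` to `ε ∣ A ∪ B ∣`, the
        -- other is left as the sign outside the sum.
        ≈⟨ *-congʳ (ε²≈1 ∣ A ∣) ⟨
      (ε ∣ A ∣ * ε ∣ A ∣) * (ε ∣ B ∣ * m)
        ≈⟨ solve 3 (λ a b m → (a :* a) :* (b :* m) := a :* ((a :* b) :* m)) ≈-refl _ _ _ ⟩
      ε ∣ A ∣ * ((ε ∣ A ∣ * ε ∣ B ∣) * m)
        ≈⟨ *-congˡ (*-congʳ (≈-trans (≈-sym (ε-+ (∣ A ∣) (∣ B ∣)))
             (^-congʳ (- 1#) (≡.sym (∣p∪q∣≡∣p∣+∣q∣ A B C B⊆))))) ⟩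
      ε ∣ A ∣ * (ε ∣ A ∪ B ∣ * m) ∎
      where
      r = rank (M / C)
      s = corank (M ∣ A)
      p = rank M′ ∸ rk M′ B
      q = nullity M′ B
      m = monomial M x y (A ∪ B)

    sums : k * ∑↓ (E M′) (λ B → ε ∣ B ∣ * monomial M′ x y B) ≈ ε ∣ A ∣ * S
    sums = begin
      k * ∑↓ (E M′) (λ B → ε ∣ B ∣ * monomial M′ x y B)
        ≡⟨ cong (λ T → k * ∑↓ T (λ B → ε ∣ B ∣ * monomial M′ x y B)) (E-minor M A⊆C C⊆E) ⟩
      k * ∑↓ (C ─ A) (λ B → ε ∣ B ∣ * monomial M′ x y B)
        ≈⟨ ∑-distribˡ-* (allSubsets N) k _ ⟩
      ∑₂ (λ B → k * (ζ B (C ─ A) * (ε ∣ B ∣ * monomial M′ x y B)))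
        ≈⟨ ∑-cong (allSubsets N) (λ B → ≈-trans
             (solve 3 (λ k z t → k :* (z :* t) := z :* (k :* t)) ≈-refl _ _ _)
             (≈-trans (𝟙-*-cong (B ⊆? (C ─ A)) (term B))
               (solve 3 (λ z a t → z :* (a :* t) := a :* (z :* t)) ≈-refl _ _ _))) ⟩
      ∑₂ (λ B → ε ∣ A ∣ * (ζ B (C ─ A) * (ε ∣ A ∪ B ∣ * monomial M x y (A ∪ B))))
        ≈⟨ ∑-distribˡ-* (allSubsets N) _ _ ⟨
      ε ∣ A ∣ * ∑↓ (C ─ A) (λ B → ε ∣ A ∪ B ∣ * monomial M x y (A ∪ B))
        ≈⟨ *-congˡ (∑↓-─ A C A⊆C (λ B → ε ∣ B ∣ * monomial M x y B)) ⟩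
      ε ∣ A ∣ * S ∎

  -- For n = 0 this is Möbius inversion: both sides are the indicator of S = E(M).
  pathSum-minorWeight : (M : Matroid N) → ∀ n (a b : Fin n → Carrier) (S : Subset N) →
    pathSum n (λ i → minorWeight M (a i) (b i)) (E M) S
      ≈ ε (rank M) * (ε (nullity M S) * ∑↑↓ S (E M) (λ B → ε ∣ B ∣ * ∏ (λ i → monomial M (a i) (b i) B)))
  pathSum-minorWeight {N} M zero a b S = ≈-sym (begin
    ε (rank M) * (ε (nullity M S) * ∑↑↓ S (E M) (λ B → ε ∣ B ∣ * 1#))
      ≈⟨ *-congˡ (*-congˡ (∑↑-cong S (λ B →
           solve 2 (λ z e → z :* (e :* con 1) := e :* z) ≈-refl _ _))) ⟩
    ε (rank M) * (ε (nullity M S) * ∑↑ S (λ B → ε ∣ B ∣ * ζ B (E M)))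
      -- The indicator of `B ⊆ E M` is the upward sum of the indicator `δ` of `E M`, which produces
      -- the double sum that `möbius` inverts.
      ≈⟨ *-congˡ (*-congˡ (∑↑-cong S (λ B → *-congˡ (≈-trans
           (≈-sym (∑₂-δ (E M) (ζ B))) (∑-cong (allSubsets N) (λ C → *-comm _ _)))))) ⟩
    ε (rank M) * (ε (nullity M S) * ∑↑ S (λ B → ε ∣ B ∣ * ∑↑ B δ))
      ≈⟨ *-congˡ (*-congˡ (möbius S δ)) ⟩
    ε (rank M) * (ε (nullity M S) * (ε ∣ S ∣ * δ S))
      ≈⟨ solve 4 (λ r k s d → r :* (k :* (s :* d)) := d :* (r :* (k :* s))) ≈-refl _ _ _ _ ⟩
    δ S * (ε (rank M) * (ε (nullity M S) * ε ∣ S ∣))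
      -- The signs have to cancel only at `S ≡ E M`, where rank and nullity add up to the
      -- cardinality.
      ≈⟨ 𝟙-*-cong (Vec.≡-dec Bool._≟_ S (E M)) signs ⟩
    δ S * 1#
      ≈⟨ *-identityʳ _ ⟩
    δ S ∎)
    where
    δ : Subset N → Carrier
    δ C = 𝟙 (Vec.≡-dec Bool._≟_ C (E M))

    signs : ∀ {S} → S ≡ E M → ε (rank M) * (ε (nullity M S) * ε ∣ S ∣) ≈ 1#
    signs refl = begin
      ε (rank M) * (ε (nullity M (E M)) * ε ∣ E M ∣)
        ≈⟨ *-congˡ (*-congʳ (ε-nullity M ⊆-refl)) ⟩
      ε (rank M) * ((ε ∣ E M ∣ * ε (rank M)) * ε ∣ E M ∣)
        ≈⟨ solve 2 (λ r e → r :* ((e :* r) :* e) := (r :* r) :* (e :* e)) ≈-refl _ _ ⟩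
      (ε (rank M) * ε (rank M)) * (ε ∣ E M ∣ * ε ∣ E M ∣)
        ≈⟨ *-cong (ε²≈1 (rank M)) (ε²≈1 ∣ E M ∣) ⟩
      1# * 1#
        ≈⟨ *-identityˡ 1# ⟩
      1# ∎
  pathSum-minorWeight {N} M (suc n) a b S = begin
    ∑₂ (λ A → ζ S A * (w A * P A))
      ≈⟨ ∑-cong (allSubsets N) summand ⟩
    ∑₂ (λ A → k * (∑↑↓ S A f * (ε ∣ A ∣ * ∑↑ A g)))
      ≈⟨ ∑-distribˡ-* (allSubsets N) k _ ⟨
    k * ∑₂ (λ A → ∑↑↓ S A f * (ε ∣ A ∣ * ∑↑ A g))
      ≈⟨ *-congˡ (∑₂-∑↑↓ S f _) ⟩
    k * ∑↑ S (λ B → f B * ∑↑ B (λ A → ε ∣ A ∣ * ∑↑ A g))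
      ≈⟨ *-congˡ (∑↑-cong S collapse) ⟩
    k * ∑↑↓ S (E M) (λ B → ε ∣ B ∣ * (h B * H B))
      ≈⟨ *-assoc _ _ _ ⟩
    ε (rank M) * (ε (nullity M S) * ∑↑↓ S (E M) (λ B → ε ∣ B ∣ * (h B * H B))) ∎
    where
    w = minorWeight M (a zero) (b zero) S
    P = pathSum n (λ i → minorWeight M (a (suc i)) (b (suc i))) (E M)
    k = ε (rank M) * ε (nullity M S)

    h H f g : Subset N → Carrier
    h B = monomial M (a zero) (b zero) B
    H B = ∏ (λ i → monomial M (a (suc i)) (b (suc i)) B)
    f B = ε ∣ B ∣ * h B
    -- The upper bound `E M` is absorbed into `g`, so the interval sum of the induction hypothesis
    -- is literally `∑↑ A g`.
    g C = ζ C (E M) * (ε ∣ C ∣ * H C)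

    ih : ∀ A → P A ≈ ε (rank M) * (ε (nullity M A) * ∑↑ A g)
    ih = pathSum-minorWeight M n (a ∘ suc) (b ∘ suc)

    -- The step ending at `A` contributes `ε (rk M A)` and the tail contributes `ε (nullity M A)`;
    -- together they give `ε ∣ A ∣`.
    inside-interval : ∀ {A} → S ⊆ A → Dec (A ⊆ E M) → w A * P A ≈ k * (∑↑↓ S A f * (ε ∣ A ∣ * ∑↑ A g))
    inside-interval {A} S⊆A (yes A⊆E) = begin
      w A * P A
        ≈⟨ *-cong (minorWeight-signed M (a zero) (b zero) S⊆A A⊆E) (≈-trans (ih A) (*-congˡ (*-congʳ (ε-nullity M A⊆E)))) ⟩
      (ε (rk M A) * (ε (nullity M S) * ∑↑↓ S A f)) * (ε (rank M) * ((ε ∣ A ∣ * ε (rk M A)) * ∑↑ A g))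
        ≈⟨ solve 6 (λ s κ x r e y → (s :* (κ :* x)) :* (r :* ((e :* s) :* y))
                                    := (s :* s) :* ((r :* κ) :* (x :* (e :* y)))) ≈-refl _ _ _ _ _ _ ⟩
      (ε (rk M A) * ε (rk M A)) * (k * (∑↑↓ S A f * (ε ∣ A ∣ * ∑↑ A g)))
        ≈⟨ ≈-trans (*-congʳ (ε²≈1 (rk M A))) (*-identityˡ _) ⟩
      k * (∑↑↓ S A f * (ε ∣ A ∣ * ∑↑ A g)) ∎
    -- The sum also meets sets outside the ground set, where the rank axioms say nothing. There the
    -- interval from `A` to `E M` is empty and both sides vanish.
    inside-interval {A} S⊆A (no A⊈E) = begin
      w A * P A                                       ≈⟨ *-congˡ (ih A) ⟩
      w A * (ε (rank M) * (ε (nullity M A) * ∑↑ A g)) ≈⟨ *-congˡ (*-congˡ (*-congˡ ∑↑g≈0)) ⟩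
      w A * (ε (rank M) * (ε (nullity M A) * 0#))
        ≈⟨ solve 6 (λ w r κ k x e → w :* (r :* (κ :* con 0)) := k :* (x :* (e :* con 0))) ≈-refl _ _ _ _ _ _ ⟩
      k * (∑↑↓ S A f * (ε ∣ A ∣ * 0#))                ≈⟨ *-congˡ (*-congˡ (*-congˡ ∑↑g≈0)) ⟨
      k * (∑↑↓ S A f * (ε ∣ A ∣ * ∑↑ A g))            ∎
      where
      ∑↑g≈0 : ∑↑ A g ≈ 0#
      ∑↑g≈0 = ∑↑↓-empty A⊈E _

    summand : ∀ A → ζ S A * (w A * P A) ≈ k * (∑↑↓ S A f * (ε ∣ A ∣ * ∑↑ A g))
    summand A with S ⊆? A
    ... | yes S⊆A = ≈-trans (*-identityˡ _) (inside-interval S⊆A (A ⊆? E M))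
    ... | no  S⊈A = ≈-trans (zeroˡ _) (≈-sym (≈-trans
      (*-congˡ (≈-trans (*-congʳ (∑↑↓-empty S⊈A f)) (zeroˡ _))) (zeroʳ k)))

    -- Möbius inversion replaces the double sum by the value of `g` at `B` itself. Of the three
    -- factors `ε ∣ B ∣`, coming from `f`, `möbius` and `g`, two cancel.
    collapse : ∀ B → f B * ∑↑ B (λ A → ε ∣ A ∣ * ∑↑ A g) ≈ ζ B (E M) * (ε ∣ B ∣ * (h B * H B))
    collapse B = begin
      (ε ∣ B ∣ * h B) * ∑↑ B (λ A → ε ∣ A ∣ * ∑↑ A g)
        ≈⟨ *-congˡ (möbius B g) ⟩
      (ε ∣ B ∣ * h B) * (ε ∣ B ∣ * (ζ B (E M) * (ε ∣ B ∣ * H B)))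
        ≈⟨ solve 4 (λ e h z H → (e :* h) :* (e :* (z :* (e :* H))) := (e :* e) :* (z :* (e :* (h :* H))))
             ≈-refl _ _ _ _ ⟩
      (ε ∣ B ∣ * ε ∣ B ∣) * (ζ B (E M) * (ε ∣ B ∣ * (h B * H B)))
        ≈⟨ ≈-trans (*-congʳ (ε²≈1 ∣ B ∣)) (*-identityˡ _) ⟩
      ζ B (E M) * (ε ∣ B ∣ * (h B * H B)) ∎

  1^k≈1 : ∀ k → 1# ^ k ≈ 1#
  1^k≈1 zero    = ≈-refl
  1^k≈1 (suc k) = ≈-trans (*-identityˡ _) (1^k≈1 k)

  -- The exponents depend on `B` but not on `i`, so the powers multiply factor by factor.
  ∏-monomial : (M : Matroid N) → ∀ n (a b : Fin n → Carrier) (B : Subset N) →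
               ∏ (λ i → monomial M (a i) (b i) B) ≈ monomial M (∏ a) (∏ b) B
  ∏-monomial M zero    a b B = ≈-sym (≈-trans
    (*-cong (1^k≈1 (rank M ∸ rk M B)) (1^k≈1 (nullity M B))) (*-identityˡ 1#))
  ∏-monomial M (suc n) a b B = begin
    (a zero ^ p * b zero ^ q) * ∏ (λ i → monomial M (a (suc i)) (b (suc i)) B)
      ≈⟨ *-congˡ (∏-monomial M n (a ∘ suc) (b ∘ suc) B) ⟩
    (a zero ^ p * b zero ^ q) * (∏ (a ∘ suc) ^ p * ∏ (b ∘ suc) ^ q)
      ≈⟨ solve 4 (λ x y z w → (x :* y) :* (z :* w) := (x :* z) :* (y :* w)) ≈-refl _ _ _ _ ⟩
    (a zero ^ p * ∏ (a ∘ suc) ^ p) * (b zero ^ q * ∏ (b ∘ suc) ^ q)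
      ≈⟨ *-cong (^-distrib-* (a zero) (∏ (a ∘ suc)) p) (^-distrib-* (b zero) (∏ (b ∘ suc)) q) ⟨
    monomial M (∏ a) (∏ b) B ∎
    where
    p = rank M ∸ rk M B
    q = nullity M B

  -- Both sides equal one signed sum over the subsets of `E M`: the left by expanding the Tutte
  -- polynomial, the right by evaluating the path sum from `⊥`.
  convolution : (M : Matroid N) → ∀ n (a b : Fin n → Carrier) →
    tutte R M (1# - ∏ a) (1# - ∏ b) ≈ ∑ (chains M n) (weight (λ i → minorWeight M (a i) (b i)))
  convolution {N} M n a b = begin
    tutte R M (1# - ∏ a) (1# - ∏ b)
      ≈⟨ tutte-signed M (∏ a) (∏ b) ⟩
    ε (rank M) * ∑↓ (E M) (λ B → ε ∣ B ∣ * monomial M (∏ a) (∏ b) B)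
      ≈⟨ *-congˡ (∑-cong (allSubsets N) (λ B → ≈-trans
           (*-congˡ (*-congˡ (≈-sym (∏-monomial M n a b B))))
           -- A trivial factor `ζ ⊥ B` turns the sum over subsets of `E M` into the interval sum
           -- starting at `⊥`.
           (≈-trans (≈-sym (*-identityˡ _)) (*-congʳ (≈-sym (𝟙-yes (⊥ ⊆? B) (⊆-min B))))))) ⟩
    ε (rank M) * ∑↑↓ ⊥ (E M) F
      ≈⟨ *-congˡ (*-identityˡ _) ⟨
    ε (rank M) * (1# * ∑↑↓ ⊥ (E M) F)
      ≈⟨ *-congˡ (*-congʳ (^-congʳ (- 1#) nullity⊥≡0)) ⟨
    ε (rank M) * (ε (nullity M ⊥) * ∑↑↓ ⊥ (E M) F)
      ≈⟨ pathSum-minorWeight M n a b ⊥ ⟨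
    pathSum n (λ i → minorWeight M (a i) (b i)) (E M) ⊥
      ≈⟨ ∑-chains M n (λ i → minorWeight M (a i) (b i)) ⟨
    ∑ (chains M n) (weight (λ i → minorWeight M (a i) (b i))) ∎
    where
    F : Subset N → Carrier
    F B = ε ∣ B ∣ * ∏ (λ i → monomial M (a i) (b i) B)

    nullity⊥≡0 : nullity M ⊥ ≡ 0
    -- The difference starts from cardinality zero, so truncation makes it zero for any value of
    -- `rk M ⊥`.
    nullity⊥≡0 = ≡.trans (cong (_∸ rk M ⊥) (∣⊥∣≡0 N)) (ℕ.0∸n≡0 (rk M ⊥))

proposition5p13 :
    ∀ {c ℓ} (K : CommutativeRing c ℓ) (n : ℕ) → n ≥ 1 → ∀ {N} (M : Matroid N) →
    let open Polynomials K (n ℕ.+ n)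
        open CommutativeRing polynomialRing
        open BigOperators polynomialRing
        a : Fin n → Carrier
        a i = X (i ↑ˡ n)
        b : Fin n → Carrier
        b i = X (n ↑ʳ i)
    in
    tutte polynomialRing M (1# - ∏ a) (1# - ∏ b)
      ≈ ∑ (chains M n) (λ A → ∏ (λ i →
          a i ^ rank (M / lookup A (suc i))
          * b i ^ corank (M ∣ lookup A (inject₁ i))
          * tutte polynomialRing (M ∣ lookup A (suc i) / lookup A (inject₁ i)) (1# - a i) (1# - b i)))
-- The identity for arbitrary ring elements is taken in the polynomial ring at its variables, the
-- first `n` serving as `a` and the last `n` as `b`.
proposition5p13 K n _ M = convolution M n (λ i → X (i ↑ˡ n)) (λ i → X (n ↑ʳ i))
  where
  open Polynomials K (n ℕ.+ n)
  open Sums polynomialRing
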